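{- Let $D=(V(D),A(D),\chi)$ be a finite, simple, connected weighted digraph with vertex set $V(D)=\{v_1,\dots,v_n\}$, arc set $A(D)$ and weight function $\chi:V(D)\cup A(D)\to(0,\infty)$, and let $M(D)$ be its weighted middle digraph. Then $$\kappa^{vertex}(M(D),\chi)=\kappa^{edge}(D,\chi)\prod_{i=1}^{n}(\chi_i+d_i)^{r_i},$$ where, for $1\le i\le n$, $\chi_i=\chi(v_i)$, $r_i=d_-(v_i)$ is the number of arcs of $D$ with head $v_i$, and $d_i=\sum_{e\in A(D),\,t(e)=v_i}\chi(e)$ is the sum of the weights of the arcs of $D$ with tail $v_i$.
   Context: Digraphs are finite and simple (no loops, no parallel arcs; opposite arcs $(u,v)$ and $(v,u)$ may both be present). Connected means that the underlying undirected graph is connected. For an arc $e=(u,v)$, $t(e)=u$ is its tail and $h(e)=v$ its head. Spanning tree: a spanning tree of a digraph $D$ is a connected subdigraph containing all vertices of $D$ and having no cycles, in which one vertex (the root) has outdegree $0$ and every other vertex has outdegree $1$ (so arcs point towards the root). $\mathcal T(D)$ denotes the set of all spanning trees of $D$ (over all roots). Complexities: for a digraph with arc weights $\chi$, the edge weighted complexity is $\kappa^{edge}(D,\chi)=\sum_{T\in\mathcal T(D)}\prod_{e\in A(T)}\chi(e)$. For a digraph with vertex weights $\chi$, the vertex weighted complexity is $\kappa^{vertex}(D,\chi)=\sum_{T\in\mathcal T(D)}\prod_{e\in A(T)}\chi(h(e))$. Empty products equal $1$. Middle digraph: $M(D)$ is the digraph with vertex set $V(D)\cup A(D)$ (disjoint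 union) whose arcs are: $(v,e)$ for $v\in V(D)$, $e\in A(D)$ with $t(e)=v$; $(e,v)$ for $e\in A(D)$, $v\in V(D)$ with $h(e)=v$; and $(e,f)$ for $e,f\in A(D)$ with $h(e)=t(f)$. Its vertices are weighted by $\chi$: a vertex $v\in V(D)$ of $M(D)$ has weight $\chi(v)$ and a vertex $e\in A(D)$ of $M(D)$ has weight $\chi(e)$. -}

module Defs where

open import Algebra.Apartness.Bundles using (HeytingField)
open import Algebra.Bundles using (CommutativeRing)
open import Axiom.UniquenessOfIdentityProofs using (module Decidable⇒UIP)
open import Data.Empty using (⊥)
open import Data.List.Base using (List; []; _∷_; _++_; map; foldr; filter; length; cartesianProduct)
open import Data.List.Membership.Propositional using (_∈_; find; lose)
open import Data.List.Membership.Propositional.Properties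
  using (∈-map⁺; ∈-map⁻; ∈-++⁺ˡ; ∈-++⁺ʳ; ∈-cartesianProduct⁺)
open import Data.List.Relation.Unary.All as All using (All; []; _∷_; all?)
open import Data.List.Relation.Unary.AllPairs using ([]; _∷_)
open import Data.List.Relation.Unary.Any using (Any; here; there; any?)
open import Data.List.Relation.Unary.Unique.Propositional using (Unique)
import Data.List.Relation.Unary.Unique.Propositional.Properties as Unique
open import Data.Nat.Base using (ℕ)
import Data.Nat.Properties as ℕ
open import Data.Product.Base using (Σ; Σ-syntax; ∃-syntax; _×_; _,_; proj₁; proj₂; uncurry)
import Data.Product.Properties as Product
open import Data.Sum.Base using (_⊎_; inj₁; inj₂)
import Data.Sum.Properties as Sum
open import Level using (Level; 0ℓ; _⊔_) renaming (suc to lsuc)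
open import Relation.Binary.Construct.Closure.Equivalence using (EqClosure)
open import Relation.Binary.Construct.Closure.ReflexiveTransitive using (Star; ε; _◅_)
open import Relation.Binary.Construct.Closure.Symmetric using (SymClosure; fwd; bwd)
open import Relation.Binary.Construct.Closure.Transitive using (TransClosure; [_]; _∷_)
  renaming (_++_ to _⁺++⁺_)
open import Relation.Binary.Core using (Rel)
open import Relation.Binary.Definitions using (DecidableEquality; Decidable; Irrelevant)
open import Relation.Binary.PropositionalEquality.Core using (_≡_; _≢_; refl; sym; cong; subst)
open import Relation.Binary.Structures using (IsStrictPartialOrder)
open import Relation.Nullary using (Dec; yes; no; ¬_; ¬?; _×-dec_; _⊎-dec_; _→-dec_; contradiction)
open import Relation.Nullary.Decidable using (map′)
import Relation.Unary as U

------------------------------------------------------------------------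
-- Finite types

record Finite (A : Set) : Set where
  field
    _≟_      : DecidableEquality A
    elements : List A
    complete : ∀ x → x ∈ elements
    unique   : Unique elements

  ∀? : {P : A → Set} → U.Decidable P → Dec (∀ x → P x)
  ∀? P? = map′ (λ ps x → All.lookup ps (complete x)) (λ p → All.universal p elements)
               (all? P? elements)

  ∃? : {P : A → Set} → U.Decidable P → Dec (∃[ x ] P x)
  ∃? P? = map′ (λ p → let x , _ , px = find p in x , px) (λ (x , px) → lose (complete x) px)
               (any? P? elements)

finite-⊎ : {A B : Set} → Finite A → Finite B → Finite (A ⊎ B)
finite-⊎ FA FB = record
  { _≟_      = Sum.≡-dec A._≟_ B._≟_
  ; elements = map inj₁ A.elements ++ map inj₂ B.elements
  ; complete = λ where
      (inj₁ a) → ∈-++⁺ˡ (∈-map⁺ inj₁ (A.complete a))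
      (inj₂ b) → ∈-++⁺ʳ (map inj₁ A.elements) (∈-map⁺ inj₂ (B.complete b))
  ; unique   = Unique.++⁺ (Unique.map⁺ Sum.inj₁-injective A.unique)
                          (Unique.map⁺ Sum.inj₂-injective B.unique)
                          (uncurry disjoint)
  }
  where
  module A = Finite FA
  module B = Finite FB
  disjoint : ∀ {x} → x ∈ map inj₁ A.elements → x ∈ map inj₂ B.elements → ⊥
  disjoint p q with ∈-map⁻ inj₁ p | ∈-map⁻ inj₂ q
  ... | _ , _ , refl | _ , _ , ()

finite-× : {A B : Set} → Finite A → Finite B → Finite (A × B)
finite-× FA FB = record
  { _≟_      = Product.≡-dec A._≟_ B._≟_
  ; elements = cartesianProduct A.elements B.elements
  ; complete = λ (a , b) → ∈-cartesianProduct⁺ (A.complete a) (B.complete b)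
  ; unique   = Unique.cartesianProduct⁺ A.unique B.unique
  }
  where
  module A = Finite FA
  module B = Finite FB

module _ {A : Set} {P : A → Set} (P? : U.Decidable P) (P-irr : U.Irrelevant P) where

  select : List A → List (Σ A P)
  select []       = []
  select (x ∷ xs) with P? x
  ... | yes p = (x , p) ∷ select xs
  ... | no  _ = select xs

  ∈-select⁺ : ∀ {x xs} (p : P x) → x ∈ xs → (x , p) ∈ select xs
  ∈-select⁺ {x} p (here refl) with P? x
  ... | yes q = here (cong (x ,_) (P-irr p q))
  ... | no ¬p = contradiction p ¬p
  ∈-select⁺ {xs = y ∷ ys} p (there i) with P? y
  ... | yes _ = there (∈-select⁺ p i)
  ... | no  _ = ∈-select⁺ p i

  ∈-select⁻ : ∀ {z} xs → z ∈ select xs → proj₁ z ∈ xs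
  ∈-select⁻ (x ∷ xs) i with P? x
  ∈-select⁻ (x ∷ xs) (here refl) | yes _ = here refl
  ∈-select⁻ (x ∷ xs) (there i)   | yes _ = there (∈-select⁻ xs i)
  ∈-select⁻ (x ∷ xs) i           | no  _ = there (∈-select⁻ xs i)

  select-unique : ∀ {xs} → Unique xs → Unique (select xs)
  select-unique [] = []
  select-unique {x ∷ xs} (x∉ ∷ u) with P? x
  ... | yes p = All.tabulate (λ i eq → All.lookup x∉ (∈-select⁻ xs i) (cong proj₁ eq))
                ∷ select-unique u
  ... | no  _ = select-unique u

  finite-Σ : Finite A → Finite (Σ A P)
  finite-Σ FA = record
    { _≟_      = λ (x , p) (y , q) → map′ (λ where refl → cong (x ,_) (P-irr p q)) (cong proj₁) (x FA.≟ y)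
    ; elements = select FA.elements
    ; complete = λ (x , p) → ∈-select⁺ p (FA.complete x)
    ; unique   = select-unique FA.unique
    }
    where module FA = Finite FA

sublists : {A : Set} → List A → List (List A)
sublists []       = [] ∷ []
sublists (x ∷ xs) = map (x ∷_) (sublists xs) ++ sublists xs

------------------------------------------------------------------------
-- Connectedness and acyclicity of a relation

Connected : {V : Set} → Rel V 0ℓ → Set
Connected R = ∀ u v → EqClosure R u v

-- Absence of directed cycles, including loops and pairs of opposite arcs.
Acyclic : {V : Set} → Rel V 0ℓ → Set
Acyclic R = ∀ v → ¬ TransClosure R v v

module _ {V : Set} (R : Rel V 0ℓ) where

  -- Via ws u v: a nonempty R-walk from u to v, found by Warshall's algorithm
  -- with intermediate vertices drawn from ws.
  Via : List V → Rel V 0ℓ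
  Via []       = R
  Via (w ∷ ws) u v = Via ws u v ⊎ (Via ws u w × Via ws w v)

  Via⇒⁺ : ∀ ws {u v} → Via ws u v → TransClosure R u v
  Via⇒⁺ []       r              = [ r ]
  Via⇒⁺ (w ∷ ws) (inj₁ p)       = Via⇒⁺ ws p
  Via⇒⁺ (w ∷ ws) (inj₂ (p , q)) = Via⇒⁺ ws p ⁺++⁺ Via⇒⁺ ws q

  Via-join : ∀ ws {u w v} → w ∈ ws → Via ws u w → Via ws w v → Via ws u v
  Via-join (w ∷ ws) (here refl) p q = inj₂ (into p , from q)
    where
    into : ∀ {u} → Via (w ∷ ws) u w → Via ws u w
    into (inj₁ p)       = p
    into (inj₂ (p , _)) = p
    from : ∀ {v} → Via (w ∷ ws) w v → Via ws w v
    from (inj₁ q)       = q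
    from (inj₂ (_ , q)) = q
  Via-join (_ ∷ ws) (there i) (inj₁ p)       (inj₁ q)       = inj₁ (Via-join ws i p q)
  Via-join (_ ∷ ws) (there i) (inj₁ p)       (inj₂ (q , r)) = inj₂ (Via-join ws i p q , r)
  Via-join (_ ∷ ws) (there i) (inj₂ (p , q)) (inj₁ r)       = inj₂ (p , Via-join ws i q r)
  Via-join (_ ∷ ws) (there i) (inj₂ (p , _)) (inj₂ (_ , r)) = inj₂ (p , r)

  Via-step : ∀ ws {u v} → R u v → Via ws u v
  Via-step []       r = r
  Via-step (_ ∷ ws) r = inj₁ (Via-step ws r)

  ⁺⇒Via : ∀ ws → (∀ v → v ∈ ws) → ∀ {u v} → TransClosure R u v → Via ws u v
  ⁺⇒Via ws c [ r ]    = Via-step ws r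
  ⁺⇒Via ws c (r ∷ rs) = Via-join ws (c _) (Via-step ws r) (⁺⇒Via ws c rs)

  ⁺⇒⋆ : ∀ {u v} → TransClosure R u v → Star R u v
  ⁺⇒⋆ [ r ]    = r ◅ ε
  ⁺⇒⋆ (r ∷ rs) = r ◅ ⁺⇒⋆ rs

  ⋆⇒≡⊎⁺ : ∀ {u v} → Star R u v → u ≡ v ⊎ TransClosure R u v
  ⋆⇒≡⊎⁺ ε        = inj₁ refl
  ⋆⇒≡⊎⁺ (r ◅ rs) with ⋆⇒≡⊎⁺ rs
  ... | inj₁ refl = inj₂ [ r ]
  ... | inj₂ rs⁺  = inj₂ (r ∷ rs⁺)

  module _ (R? : Decidable R) where

    via? : ∀ ws → Decidable (Via ws)
    via? []       u v = R? u v
    via? (w ∷ ws) u v = via? ws u v ⊎-dec (via? ws u w ×-dec via? ws w v)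

    ⁺? : Finite V → Decidable (TransClosure R)
    ⁺? F u v = map′ (Via⇒⁺ elements) (⁺⇒Via elements complete) (via? elements u v)
      where open Finite F

    ⋆? : Finite V → Decidable (Star R)
    ⋆? F u v = map′ (λ where (inj₁ refl) → ε
                             (inj₂ rs)   → ⁺⇒⋆ rs)
                    ⋆⇒≡⊎⁺ ((u ≟ v) ⊎-dec ⁺? F u v)
      where open Finite F

symClosure? : {V : Set} {R : Rel V 0ℓ} → Decidable R → Decidable (SymClosure R)
symClosure? R? u v = map′ (λ where (inj₁ r) → fwd r
                                   (inj₂ r) → bwd r)
                          (λ where (fwd r) → inj₁ r
                                   (bwd r) → inj₂ r)
                          (R? u v ⊎-dec R? v u)

connected? : {V : Set} {R : Rel V 0ℓ} → Finite V → Decidable R → Dec (Connected R)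
connected? F R? = ∀? λ u → ∀? λ v → ⋆? _ (symClosure? R?) F u v
  where open Finite F

acyclic? : {V : Set} {R : Rel V 0ℓ} → Finite V → Decidable R → Dec (Acyclic R)
acyclic? F R? = ∀? λ v → ¬? (⁺? _ R? F v v)
  where open Finite F

------------------------------------------------------------------------
-- Finite simple digraphs

-- Irrelevance of _⟶_ excludes parallel arcs.
record Digraph : Set₁ where
  infix 4 _⟶_ _⟶?_
  field
    V            : Set
    V-finite     : Finite V
    _⟶_          : Rel V 0ℓ
    _⟶?_         : Decidable _⟶_
    ⟶-irrelevant : Irrelevant _⟶_
    loopless     : ∀ v → ¬ (v ⟶ v)

  A : Set
  A = Σ[ uv ∈ V × V ] uncurry _⟶_ uv

  t h : A → V
  t ((u , _) , _) = u
  h ((_ , v) , _) = v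

  A-finite : Finite A
  A-finite = finite-Σ (uncurry _⟶?_) ⟶-irrelevant (finite-× V-finite V-finite)

  open Finite V-finite public using (_≟_) renaming (elements to vertices)
  open Finite A-finite public using () renaming (elements to arcs)

  outdegree : List A → V → ℕ
  outdegree S v = length (filter (λ e → t e ≟ v) S)

  d₋ : V → ℕ
  d₋ v = length (filter (λ e → h e ≟ v) arcs)

  -- The arc relation of the spanning subdigraph (V , S).
  ArcIn : List A → Rel V 0ℓ
  ArcIn S u v = Any (λ e → t e ≡ u × h e ≡ v) S

  arcIn? : ∀ S → Decidable (ArcIn S)
  arcIn? S u v = any? (λ e → (t e ≟ u) ×-dec (h e ≟ v)) S

  Root : List A → V → Set
  Root S r = outdegree S r ≡ 0 × (∀ v → v ≢ r → outdegree S v ≡ 1)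

  IsSpanningTree : List A → Set
  IsSpanningTree S = Connected (ArcIn S) × Acyclic (ArcIn S) × ∃[ r ] Root S r

  isSpanningTree? : U.Decidable IsSpanningTree
  isSpanningTree? S =
    connected? V-finite (arcIn? S) ×-dec
    acyclic? V-finite (arcIn? S) ×-dec
    ∃? (λ r → (outdegree S r ℕ.≟ 0) ×-dec
              ∀? (λ v → ¬? (v ≟ r) →-dec (outdegree S v ℕ.≟ 1)))
    where open Finite V-finite using (∀?; ∃?)

  -- A spanning subdigraph is given by its arc set, and since arcs is free of
  -- repetitions each set of arcs is listed exactly once by sublists arcs.
  spanningTrees : List (List A)
  spanningTrees = filter isSpanningTree? (sublists arcs)

IsConnected : Digraph → Set
IsConnected D = Connected (Digraph._⟶_ D)

------------------------------------------------------------------------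
-- The middle digraph

module _ (D : Digraph) where
  open Digraph D

  MiddleArc : Rel (V ⊎ A) 0ℓ
  MiddleArc (inj₁ _) (inj₁ _) = ⊥
  MiddleArc (inj₁ v) (inj₂ e) = t e ≡ v
  MiddleArc (inj₂ e) (inj₁ v) = h e ≡ v
  MiddleArc (inj₂ e) (inj₂ f) = h e ≡ t f

  middleArc? : Decidable MiddleArc
  middleArc? (inj₁ _) (inj₁ _) = no λ ()
  middleArc? (inj₁ v) (inj₂ e) = t e ≟ v
  middleArc? (inj₂ e) (inj₁ v) = h e ≟ v
  middleArc? (inj₂ e) (inj₂ f) = h e ≟ t f

  middleArc-irrelevant : Irrelevant MiddleArc
  middleArc-irrelevant {inj₁ _} {inj₁ _} ()
  middleArc-irrelevant {inj₁ _} {inj₂ _} = Decidable⇒UIP.≡-irrelevant _≟_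
  middleArc-irrelevant {inj₂ _} {inj₁ _} = Decidable⇒UIP.≡-irrelevant _≟_
  middleArc-irrelevant {inj₂ _} {inj₂ _} = Decidable⇒UIP.≡-irrelevant _≟_

  middleArc-loopless : ∀ x → ¬ MiddleArc x x
  middleArc-loopless (inj₁ _) ()
  middleArc-loopless (inj₂ ((u , v) , u⟶v)) v≡u = loopless u (subst (u ⟶_) v≡u u⟶v)

  M : Digraph
  M = record
    { V            = V ⊎ A
    ; V-finite     = finite-⊎ V-finite A-finite
    ; _⟶_          = MiddleArc
    ; _⟶?_         = middleArc?
    ; ⟶-irrelevant = λ {x} {y} → middleArc-irrelevant {x} {y}
    ; loopless     = middleArc-loopless
    }

------------------------------------------------------------------------
-- Ordered fields

-- The real numbers are an instance, constructively as well as classically: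
-- order is not assumed decidable, and apartness means comparability.
record OrderedField c ℓ₁ ℓ₂ ℓ₃ : Set (lsuc (c ⊔ ℓ₁ ⊔ ℓ₂ ⊔ ℓ₃)) where
  field
    heytingField : HeytingField c ℓ₁ ℓ₂

  open HeytingField heytingField public

  infix 4 _<_
  field
    _<_                  : Rel Carrier ℓ₃
    isStrictPartialOrder : IsStrictPartialOrder _≈_ _<_
    #⇒<⊎>                : ∀ {x y} → x # y → x < y ⊎ y < x
    <⇒#                  : ∀ {x y} → x < y → x # y
    +-monoˡ-<            : ∀ {x y} z → x < y → x + z < y + z
    *-pos                : ∀ {x y} → 0# < x → 0# < y → 0# < x * y

  commutativeRing : CommutativeRing c ℓ₁
  commutativeRing = record { isCommutativeRing = isCommutativeRing }

------------------------------------------------------------------------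
-- Weighted complexities

module Complexity {c ℓ₁ ℓ₂ ℓ₃} (F : OrderedField c ℓ₁ ℓ₂ ℓ₃) where
  open OrderedField F public using (Carrier; _≈_; _<_; _+_; _*_; 0#; 1#)
  open OrderedField F using (commutativeRing)
  open CommutativeRing commutativeRing using (semiring)
  open import Algebra.Properties.Semiring.Exp semiring public using (_^_)

  ∑ ∏ : {I : Set} → List I → (I → Carrier) → Carrier
  ∑ is f = foldr _+_ 0# (map f is)
  ∏ is f = foldr _*_ 1# (map f is)

  infix 5 ∑ ∏
  syntax ∑ is (λ i → x) = ∑[ i ∈ is ] x
  syntax ∏ is (λ i → x) = ∏[ i ∈ is ] x

  module _ (D : Digraph) where
    open Digraph D

    κ-edge : (A → Carrier) → Carrier
    κ-edge χ = ∑[ T ∈ spanningTrees ] ∏[ e ∈ T ] χ e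

    κ-vertex : (V → Carrier) → Carrier
    κ-vertex χ = ∑[ T ∈ spanningTrees ] ∏[ e ∈ T ] χ (h e)

    d : (A → Carrier) → V → Carrier
    d χ v = ∑[ e ∈ filter (λ e → t e ≟ v) arcs ] χ e

-- The trees of M (D) are counted as acyclic maps x ↦ parent with exactly one root, summed
-- one vertex at a time. In M (D) an arc e with head v sees what v sees, and in addition v
-- itself with weight χ v. Subtracting the row of v from the row of e in the Laplacian
-- therefore leaves a single arc e → v of weight χ v + d v; the sum of minors over all roots
-- is unaffected, but e can no longer be a root. Doing this for every e and contracting the
-- arcs e → h e leaves the weighted trees of D. The row operation is proved bijectively, so
-- neither determinants nor subtraction are needed.

module Submission where

open import Defs
open import Algebra.Bundles using (CommutativeRing; CommutativeSemiring)
open import Data.Bool.Base using (if_then_else_; true; false)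
open import Data.List.Base
  using (List; []; _∷_; _++_; map; foldr; filter; length; concatMap; cartesianProduct; fromMaybe)
open import Data.List.Membership.Propositional using (_∈_; _∉_; find; lose)
open import Data.List.Membership.Propositional.Properties
  using (∈-∃++; ∈-insert; ∈-++⁺ʳ; ∈-filter⁺; ∈-filter⁻; ∈-map⁺; ∈-map⁻)
open import Data.List.Properties
  using (filter-accept; filter-reject; filter-++; ++-assoc; ++-identityʳ; map-id)
open import Data.List.Relation.Binary.Permutation.Propositional as ↭ using (_↭_; ↭⇒↭ₛ)
open import Data.List.Relation.Binary.Permutation.Propositional.Properties
  using (shift; ++-comm; ++⁺ˡ; filter-↭; ↭-length; Any-resp-↭; ∈-resp-↭)
import Data.List.Relation.Binary.Permutation.Setoid.Properties as ↭ₛ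
open import Data.List.Relation.Unary.All as All using ([]; _∷_)
open import Data.List.Relation.Unary.AllPairs using ([]; _∷_)
open import Data.List.Relation.Unary.Any using (here; there)
open import Data.List.Relation.Unary.Unique.Propositional using (Unique)
open import Data.Maybe.Base as Maybe using (Maybe; just; nothing; maybe)
import Data.Maybe.Properties as Maybe
open import Data.Maybe.Relation.Unary.Any using (Any; just; dec)
open import Data.Nat.Base using (ℕ)
open import Data.Product.Base using (_×_; _,_; ∃-syntax; proj₁; proj₂; map₂; uncurry)
open import Data.Sum.Base using (_⊎_; inj₁; inj₂)
import Data.Sum.Base as Sum using ([_,_])
import Data.Sum.Properties as Sum
open import Function.Base using (_∘_; id; const; case_of_)
open import Function.Definitions using (Injective)
open import Level using (Level)
import Relation.Binary.Construct.Closure.Equivalence as Eq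
open import Relation.Binary.Construct.Closure.ReflexiveTransitive using (Star; ε; _◅_; _◅◅_)
open import Relation.Binary.Construct.Closure.Symmetric using (fwd; bwd)
open import Relation.Binary.Construct.Closure.Transitive using (TransClosure; [_]; _∷_)
open import Relation.Binary.Definitions using (DecidableEquality)
open import Relation.Binary.PropositionalEquality as ≡ using (_≡_; _≢_; _≗_; refl)
open import Relation.Nullary using (Dec; yes; no; ¬_; ¬?; does; contradiction; _×-dec_)
open import Relation.Nullary.Decidable using (map′; dec-true; dec-false)
import Relation.Unary as U

-- Parent maps and rooted trees

-- The row operation becomes a bijection once the map `N` outside two vertices `a`, `b` is fixed and
-- their successors, `y` at `a` and `z` at `b`, range over one and the same row. Whether the result
-- is a tree is then decided by where `N` leads from `y` and `z`. If `z` leads to `a`, the two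
-- vertices can trade places, so that `a` goes to `b` and `b` to `y`. If not, a walk from `b` to the
-- root avoids `a`, and `a` may be attached to `b` as long as `y` does not lead back to `a`. The
-- first case leaves a condition on `z` times a term in `y`, the second a condition on `y` times the
-- same term in `z`. The double sum therefore factors, and the two conditions together collect the
-- weight of every entry of the row except the option of being a root. For the row of a vertex `v`
-- of `D` this weight is `d v`, and the extra entry of an arc with head `v` adds `χ v`. Being a root
-- is an option of weight 1 in a row, so that one sum covers all roots; this also lets the exchange
-- move the root from `a` to `b`. Only rows of arcs are ever replaced, so each factor is independent
-- of the order of the contractions.

module _ {X : Set} where

  Next : (X → Maybe X) → X → X → Set
  Next f x y = f x ≡ just y

  data Leads (f : X → Maybe X) : X → X → Set where
    stop : ∀ {x} → f x ≡ nothing → Leads f x x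
    step : ∀ {x y r} → Next f x y → Leads f y r → Leads f x r

  -- Derivations of `Leads` are finite, which excludes cycles, and a second root would lead only to
  -- itself. Leaving `r` existential lets two maps with different roots be compared.
  Tree : (X → Maybe X) → Set
  Tree f = ∃[ r ] ∀ x → Leads f x r

  module _ {f : X → Maybe X} where

    leads-end : ∀ {x r} → Leads f x r → f r ≡ nothing
    leads-end (stop p)   = p
    leads-end (step _ l) = leads-end l

    leads-unique : ∀ {x r s} → Leads f x r → Leads f x s → r ≡ s
    leads-unique (stop _)   (stop _)   = refl
    leads-unique (stop p)   (step q _) = case ≡.trans (≡.sym p) q of λ ()
    leads-unique (step p _) (stop q)   = case ≡.trans (≡.sym q) p of λ ()
    leads-unique (step p l) (step q m) with refl ← ≡.trans (≡.sym p) q = leads-unique l m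

    leads-tail : ∀ {x y r} → Next f x y → Leads f x r → Leads f y r
    leads-tail p (stop q)   = case ≡.trans (≡.sym q) p of λ ()
    leads-tail p (step q l) with refl ← ≡.trans (≡.sym p) q = l

    -- Since `f` is single-valued, a cycle through a vertex can be rotated to its successor;
    -- following the walk carries the cycle to the root, which has no successor.
    leads-acyclic : ∀ {x r} → Leads f x r → ¬ TransClosure (Next f) x x
    leads-acyclic (stop p)   c = case ≡.trans (≡.sym p) (proj₂ (head c)) of λ ()
      where
      head : ∀ {x y} → TransClosure (Next f) x y → ∃[ z ] Next f x z
      head [ q ]   = _ , q
      head (q ∷ _) = _ , q
    leads-acyclic (step p l) c = leads-acyclic l (rotate p c)
      where
      snoc : ∀ {x y z} → TransClosure (Next f) x y → Next f y z → TransClosure (Next f) x z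
      snoc [ p ]   q = p ∷ [ q ]
      snoc (p ∷ c) q = p ∷ snoc c q
      rotate : ∀ {x y} → Next f x y → TransClosure (Next f) x x → TransClosure (Next f) y y
      rotate p [ q ]   with refl ← ≡.trans (≡.sym p) q = [ p ]
      rotate p (q ∷ c) with refl ← ≡.trans (≡.sym p) q = snoc c p

    leads⇒⋆ : ∀ {x r} → Leads f x r → Star (Next f) x r
    leads⇒⋆ (stop _)   = ε
    leads⇒⋆ (step p l) = p ◅ leads⇒⋆ l

    ⋆⇒leads : ∀ {x r} → f r ≡ nothing → Star (Next f) x r → Leads f x r
    ⋆⇒leads q ε       = stop q
    ⋆⇒leads q (p ◅ s) = step p (⋆⇒leads q s)

    ⋆⇒⁺ : ∀ {x y z} → Next f x y → Star (Next f) y z → TransClosure (Next f) x z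
    ⋆⇒⁺ p ε       = [ p ]
    ⋆⇒⁺ p (q ◅ s) = p ∷ ⋆⇒⁺ q s

    no-return : ∀ {x y r} → Next f x y → Star (Next f) y x → ¬ Leads f x r
    no-return p s l = leads-acyclic l (⋆⇒⁺ p s)

  leads-cong : ∀ {f g x r} → f ≗ g → Leads f x r → Leads g x r
  leads-cong e (stop p)   = stop (≡.trans (≡.sym (e _)) p)
  leads-cong e (step p l) = step (≡.trans (≡.sym (e _)) p) (leads-cong e l)

  tree-cong : ∀ {f g} → f ≗ g → Tree f → Tree g
  tree-cong e (r , l) = r , λ x → leads-cong e (l x)

  module _ (X-finite : Finite X) where
    open Finite X-finite

    abstract
      -- Following `f` need not terminate, so the question is reduced to reachability, decidable on
      -- a finite type, together with `r` being a root.
      leads? : ∀ f x r → Dec (Leads f x r)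
      leads? f x r = map′ (λ (p , s) → ⋆⇒leads p s) (λ l → leads-end l , leads⇒⋆ l)
        (Maybe.≡-dec _≟_ (f r) nothing ×-dec
         ⋆? (Next f) (λ x y → Maybe.≡-dec _≟_ (f x) (just y)) X-finite x r)

      tree? : ∀ f → Dec (Tree f)
      tree? f = ∃? λ r → ∀? λ x → leads? f x r

-- F is obtained from N, in which a and b are roots, by redirecting a to y and b to z.
module Reconnect {X : Set} (_≟_ : DecidableEquality X) {a b : X} (a≢b : a ≢ b) {N : X → Maybe X}
  (N-a : N a ≡ nothing) (N-b : N b ≡ nothing) where

  record Reconnects (F : X → Maybe X) (y z : Maybe X) : Set where
    constructor reconnects
    field
      at-a : F a ≡ y
      at-b : F b ≡ z
      off  : ∀ {x} → x ≢ a → x ≢ b → F x ≡ N x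

  -- Mentions only `N`, so it can be read off one reconnection by `settle` and used to build another
  -- by `tree⁺`.
  Settled : X → X → Set
  Settled r x = Leads N x a ⊎ Leads N x b ⊎ Leads N x r

  Hits Misses : Maybe X → Set
  Hits   = Any (λ y → Leads N y a)
  Misses = Any (λ y → ¬ Leads N y a)

  module _ {F y z} (F≈N : Reconnects F y z) where
    open Reconnects F≈N

    next⇒ : ∀ {x y} → Next N x y → Next F x y
    next⇒ p = ≡.trans (off (λ where refl → case ≡.trans (≡.sym N-a) p of λ ())
                         (λ where refl → case ≡.trans (≡.sym N-b) p of λ ())) p

    glue : ∀ {x s r} → Leads N x s → Leads F s r → Leads F x r
    glue (stop _)   m = m
    glue (step p l) m = step (next⇒ p) (glue l m)

    walk : ∀ {x s} → Leads N x s → Star (Next F) x s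
    walk (stop _)   = ε
    walk (step p l) = next⇒ p ◅ walk l

    settle : ∀ {x r} → Leads F x r → Settled r x
    settle {x} l with x ≟ a | x ≟ b
    ... | yes refl | _        = inj₁ (stop N-a)
    ... | no _     | yes refl = inj₂ (inj₁ (stop N-b))
    settle (stop p)   | no x≢a | no x≢b = inj₂ (inj₂ (stop (≡.trans (≡.sym (off x≢a x≢b)) p)))
    settle (step p l) | no x≢a | no x≢b with settle l | ≡.trans (≡.sym (off x≢a x≢b)) p
    ... | inj₁ m        | q = inj₁ (step q m)
    ... | inj₂ (inj₁ m) | q = inj₂ (inj₁ (step q m))
    ... | inj₂ (inj₂ m) | q = inj₂ (inj₂ (step q m))

    -- The walks from `a` and `b` are all that has to be checked: every other vertex follows `N`,
    -- which survives in `F`, until it meets `a`, `b` or the root.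
    tree⁺ : ∀ {r} → (∀ x → Settled r x) → Leads F a r → Leads F b r → Tree F
    tree⁺ settled la lb = _ , λ x → case settled x of λ where
      (inj₁ m)        → glue m la
      (inj₂ (inj₁ m)) → glue m lb
      (inj₂ (inj₂ m)) → glue m (stop (leads-end la))

  -- Needed when the exchange moves the root between `a` and `b`: the old root is then itself one of
  -- the two, and the third alternative is absorbed by the others.
  retarget : ∀ {r s} → r ≡ a ⊎ r ≡ b → (∀ x → Settled r x) → ∀ x → Settled s x
  retarget r≡ settled x with settled x
  ... | inj₁ m        = inj₁ m
  ... | inj₂ (inj₁ m) = inj₂ (inj₁ m)
  ... | inj₂ (inj₂ m) with r≡
  ...   | inj₁ refl = inj₁ m
  ...   | inj₂ refl = inj₂ (inj₁ m)

  -- If both `a` and `b` have successors in `F`, its root lies elsewhere, where all reconnections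
  -- agree with `N`.
  transfer-root : ∀ {F G y z y′ z′ r} → Reconnects F (just y) (just z) → Reconnects G y′ z′ →
                  F r ≡ nothing → G r ≡ nothing
  transfer-root (reconnects p q f) (reconnects _ _ g) e = ≡.trans (≡.trans (g r≢a r≢b) (≡.sym (f r≢a r≢b))) e
    where
    r≢a = λ where refl → case ≡.trans (≡.sym p) e of λ ()
    r≢b = λ where refl → case ≡.trans (≡.sym q) e of λ ()

  -- In `F` the vertices sit on a chain from `b` through `z` to `a` and on to `y`; in `G` the chain
  -- runs from `a` to `b` and on to `y`. Both leave through `y`, so they reach the root under the
  -- same condition. If `y` is `nothing`, the root moves from `a` to `b`.
  tree-exchange⁺ : ∀ {F G y z} → Reconnects F y z → Reconnects G (just b) y → Hits z → Tree F → Tree G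
  tree-exchange⁺ {y = nothing} F≈N@(reconnects Fa Fb _) G≈N@(reconnects Ga Gb _) (just h) (r , l)
    with refl ← leads-unique (l a) (stop Fa) =
      tree⁺ G≈N (retarget (inj₁ refl) (λ x → settle F≈N (l x))) (step Ga (stop Gb)) (stop Gb)
  tree-exchange⁺ {F} {G} {just y} F≈N@(reconnects Fa Fb _) G≈N@(reconnects Ga Gb _) (just h) (r , l)
    with settle F≈N (leads-tail Fa (l a))
  ... | inj₁ m        = contradiction (l a) (no-return Fa (walk F≈N m))
  ... | inj₂ (inj₁ m) = contradiction (l a) (no-return Fa (walk F≈N m ◅◅ Fb ◅ walk F≈N h))
  ... | inj₂ (inj₂ m) = tree⁺ G≈N (λ x → settle F≈N (l x)) (step Ga lb) lb
    where
    lb : Leads G b r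
    lb = step Gb (glue G≈N m (stop (transfer-root F≈N G≈N (leads-end (l a)))))

  tree-exchange⁻ : ∀ {F G y z} → Reconnects F y z → Reconnects G (just b) y → Hits z → Tree G → Tree F
  tree-exchange⁻ {y = nothing} F≈N@(reconnects Fa Fb _) G≈N@(reconnects Ga Gb _) (just h) (r , l)
    with refl ← leads-unique (l b) (stop Gb) =
      tree⁺ F≈N (retarget (inj₂ refl) (λ x → settle G≈N (l x)))
        (stop Fa) (step Fb (glue F≈N h (stop Fa)))
  tree-exchange⁻ {F} {G} {just y} F≈N@(reconnects Fa Fb _) G≈N@(reconnects Ga Gb _) (just h) (r , l)
    with settle G≈N (leads-tail Gb (l b))
  ... | inj₁ m        = contradiction (l b) (no-return Gb (walk G≈N m ◅◅ Ga ◅ ε))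
  ... | inj₂ (inj₁ m) = contradiction (l b) (no-return Gb (walk G≈N m))
  ... | inj₂ (inj₂ m) = tree⁺ F≈N (λ x → settle G≈N (l x)) la (step Fb (glue F≈N h la))
    where
    la : Leads F a r
    la = step Fa (glue F≈N m (stop (transfer-root G≈N F≈N (leads-end (l b)))))

  hit⇒¬tree : ∀ {G z} → Reconnects G (just b) z → Hits z → ¬ Tree G
  hit⇒¬tree G≈N@(reconnects Ga Gb _) (just h) (r , l) = no-return Gb (walk G≈N h ◅◅ Ga ◅ ε) (l b)

  -- The walk from `b` never visits `a`, so it does not notice a change of successor there.
  transfer-b : ∀ {F G y y′ z} → Reconnects F (just y) z → Reconnects G y′ z → ¬ Hits z →
               ∀ {r} → Leads F b r → Leads G b r
  transfer-b {z = nothing} (reconnects _ Fb _) (reconnects _ Gb _) _ l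
    with refl ← leads-unique l (stop Fb) = stop Gb
  transfer-b {z = just z} F≈N@(reconnects _ Fb _) G≈N@(reconnects _ Gb _) ¬hit l
    with settle F≈N (leads-tail Fb l)
  ... | inj₁ m        = contradiction (just m) ¬hit
  ... | inj₂ (inj₁ m) = contradiction l (no-return Fb (walk F≈N m))
  ... | inj₂ (inj₂ m) = step Gb (glue G≈N m (stop (transfer-root F≈N G≈N (leads-end l))))

  -- `Misses y` also rules out that `a` is the root: the walk from `b` would then have to end in
  -- `a`, against `¬ Hits z`. If `y` is a vertex leading to `a`, there is a cycle.
  tree-redirect⁺ : ∀ {F G y z} → Reconnects F y z → Reconnects G (just b) z → ¬ Hits z →
                   Tree F → Misses y × Tree G
  tree-redirect⁺ {F} {G} {just y} F≈N@(reconnects Fa Fb _) G≈N@(reconnects Ga Gb _) ¬hit (r , l) =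
    just (λ m → no-return Fa (walk F≈N m) (l a)) ,
    tree⁺ G≈N (λ x → settle F≈N (l x)) (step Ga lb) lb
    where
    lb : Leads G b r
    lb = transfer-b F≈N G≈N ¬hit (l b)
  -- Both `a` and `b` would be roots.
  tree-redirect⁺ {y = nothing} {nothing} (reconnects Fa Fb _) _ _ (r , l) =
    contradiction (≡.trans (leads-unique (stop Fa) (l a)) (leads-unique (l b) (stop Fb))) a≢b
  tree-redirect⁺ {y = nothing} {just _} F≈N@(reconnects Fa Fb _) _ ¬hit (r , l)
    with refl ← leads-unique (l a) (stop Fa) | settle F≈N (leads-tail Fb (l b))
  ... | inj₁ m        = contradiction (just m) ¬hit
  ... | inj₂ (inj₁ m) = contradiction (l b) (no-return Fb (walk F≈N m))
  ... | inj₂ (inj₂ m) = contradiction (just m) ¬hit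

  tree-redirect⁻ : ∀ {F G y z} → Reconnects F y z → Reconnects G (just b) z → ¬ Hits z →
                   Misses y → Tree G → Tree F
  tree-redirect⁻ {F} F≈N@(reconnects Fa Fb _) G≈N@(reconnects Ga Gb _) ¬hit (just miss) (r , l) =
    tree⁺ F≈N (λ x → settle G≈N (l x)) la lb
    where
    lb : Leads F b r
    lb = transfer-b G≈N F≈N ¬hit (l b)
    la : Leads F a r
    la with settle G≈N (l _)
    ... | inj₁ m        = contradiction m miss
    ... | inj₂ (inj₁ m) = step Fa (glue F≈N m lb)
    ... | inj₂ (inj₂ m) = step Fa (glue F≈N m (stop (leads-end lb)))

-- Weighted sums over maps

module Update {X : Set} {c} {C : Set c} (_≟_ : DecidableEquality X) where

  infixl 8 _[_≔_]
  _[_≔_] : (X → C) → X → C → X → C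
  (f [ a ≔ c ]) x = if does (x ≟ a) then c else f x

  update-same : ∀ f a c → (f [ a ≔ c ]) a ≡ c
  update-same f a c rewrite dec-true (a ≟ a) refl = refl

  update-other : ∀ f {a c x} → x ≢ a → (f [ a ≔ c ]) x ≡ f x
  update-other f {a} {c} {x} x≢a rewrite dec-false (x ≟ a) x≢a = refl

  update-cong : ∀ {f g} a c → f ≗ g → f [ a ≔ c ] ≗ g [ a ≔ c ]
  update-cong a c e x with does (x ≟ a)
  ... | true  = refl
  ... | false = e x

  update-comm : ∀ f {a b c d} → a ≢ b → f [ a ≔ c ] [ b ≔ d ] ≗ f [ b ≔ d ] [ a ≔ c ]
  update-comm f {a} {b} a≢b x with x ≟ b | x ≟ a
  ... | yes refl | yes refl = contradiction refl a≢b
  ... | yes _    | no _     = refl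
  ... | no _     | yes _    = refl
  ... | no _     | no _     = refl

module Sums {c ℓ} (R : CommutativeSemiring c ℓ) where
  open CommutativeSemiring R
    renaming (refl to ≈-refl; sym to ≈-sym; trans to ≈-trans)
  open import Algebra.Properties.Semiring.Exp semiring using (_^_)
  open import Relation.Binary.Reasoning.Setoid setoid
  open import Algebra.Properties.CommutativeSemigroup +-commutativeSemigroup
    using () renaming (interchange to +-interchange)
  open import Algebra.Properties.CommutativeSemigroup *-commutativeSemigroup
    using () renaming (x∙yz≈y∙xz to *-left-comm)

  ∑ : ∀ {i} {I : Set i} → List I → (I → Carrier) → Carrier
  ∑ is f = foldr _+_ 0# (map f is)

  ∏ : ∀ {i} {I : Set i} → List I → (I → Carrier) → Carrier
  ∏ is f = foldr _*_ 1# (map f is)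

  infix 5 ∑
  syntax ∑ is (λ i → x) = ∑[ i ∈ is ] x

  ⟦_⟧ : ∀ {p} {P : Set p} → Dec P → Carrier
  ⟦ P? ⟧ = if does P? then 1# else 0#

  ⟦⟧-true : ∀ {p} {P : Set p} (P? : Dec P) → P → ⟦ P? ⟧ ≡ 1#
  ⟦⟧-true P? p rewrite dec-true P? p = refl

  ⟦⟧-false : ∀ {p} {P : Set p} (P? : Dec P) → ¬ P → ⟦ P? ⟧ ≡ 0#
  ⟦⟧-false P? ¬p rewrite dec-false P? ¬p = refl

  ⟦⟧-cong : ∀ {p q} {P : Set p} {Q : Set q} (P? : Dec P) (Q? : Dec Q) →
            (P → Q) → (Q → P) → ⟦ P? ⟧ ≡ ⟦ Q? ⟧
  ⟦⟧-cong (yes p) Q? f g = ≡.sym (⟦⟧-true Q? (f p))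
  ⟦⟧-cong (no ¬p) Q? f g = ≡.sym (⟦⟧-false Q? (¬p ∘ g))

  ⟦⟧-complement : ∀ {p} {P : Set p} (P? : Dec P) → ⟦ P? ⟧ + ⟦ ¬? P? ⟧ ≈ 1#
  ⟦⟧-complement (yes _) = +-identityʳ 1#
  ⟦⟧-complement (no  _) = +-identityˡ 1#

  private variable
    a b : Level
    I : Set a
    J : Set b

  ∑-cong-∈ : ∀ (is : List I) {f g} → (∀ i → i ∈ is → f i ≈ g i) → ∑ is f ≈ ∑ is g
  ∑-cong-∈ []       e = ≈-refl
  ∑-cong-∈ (i ∷ is) e = +-cong (e i (here refl)) (∑-cong-∈ is (λ j j∈ → e j (there j∈)))

  ∑-cong : ∀ (is : List I) {f g} → (∀ i → f i ≈ g i) → ∑ is f ≈ ∑ is g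
  ∑-cong is e = ∑-cong-∈ is (λ i _ → e i)

  ∑-zero : ∀ (is : List I) → ∑[ i ∈ is ] 0# ≈ 0#
  ∑-zero []       = ≈-refl
  ∑-zero (i ∷ is) = ≈-trans (+-identityˡ _) (∑-zero is)

  ∑-+ : ∀ (is : List I) f g → ∑[ i ∈ is ] (f i + g i) ≈ ∑ is f + ∑ is g
  ∑-+ []       f g = ≈-sym (+-identityˡ 0#)
  ∑-+ (i ∷ is) f g = ≈-trans (+-congˡ (∑-+ is f g)) (+-interchange _ _ _ _)

  ∑-*ˡ : ∀ (is : List I) a f → ∑[ i ∈ is ] (a * f i) ≈ a * ∑ is f
  ∑-*ˡ []       a f = ≈-sym (zeroʳ a)
  ∑-*ˡ (i ∷ is) a f = ≈-trans (+-congˡ (∑-*ˡ is a f)) (≈-sym (distribˡ a _ _))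

  ∑-++ : ∀ (is js : List I) f → ∑ (is ++ js) f ≈ ∑ is f + ∑ js f
  ∑-++ []       js f = ≈-sym (+-identityˡ _)
  ∑-++ (i ∷ is) js f = ≈-trans (+-congˡ (∑-++ is js f)) (≈-sym (+-assoc _ _ _))

  ∑-map : ∀ (g : J → I) (js : List J) f → ∑ (map g js) f ≡ ∑ js (f ∘ g)
  ∑-map g []       f = refl
  ∑-map g (j ∷ js) f = ≡.cong (f (g j) +_) (∑-map g js f)

  ∑-comm : ∀ (is : List I) (js : List J) (f : I → J → Carrier) →
           ∑[ i ∈ is ] (∑[ j ∈ js ] f i j) ≈ ∑[ j ∈ js ] (∑[ i ∈ is ] f i j)
  ∑-comm []       js f = ≈-sym (∑-zero js)
  ∑-comm (i ∷ is) js f = ≈-trans (+-congˡ (∑-comm is js f)) (≈-sym (∑-+ js _ _))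

  ∑-filter : ∀ {p} {P : U.Pred I p} (P? : U.Decidable P) (is : List I) f →
             ∑ (filter P? is) f ≈ ∑[ i ∈ is ] (⟦ P? i ⟧ * f i)
  ∑-filter P? []       f = ≈-refl
  ∑-filter P? (i ∷ is) f with does (P? i)
  ... | true  = +-cong (≈-sym (*-identityˡ _)) (∑-filter P? is f)
  ... | false = ≈-trans (∑-filter P? is f) (≈-trans (≈-sym (+-identityˡ _)) (+-congʳ (≈-sym (zeroˡ _))))

  ∑-single : (_≟_ : DecidableEquality I) → ∀ {is a} → a ∈ is → Unique is → ∀ (f : I → Carrier) →
             ∑[ i ∈ is ] (⟦ a ≟ i ⟧ * f i) ≈ f a
  ∑-single _≟_ {a ∷ is} (here refl) (a∉ ∷ _) f = begin
    ⟦ a ≟ a ⟧ * f a + (∑[ i ∈ is ] (⟦ a ≟ i ⟧ * f i))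
      ≈⟨ +-cong (≈-trans (*-congʳ (reflexive (⟦⟧-true (a ≟ a) refl))) (*-identityˡ _))
                (∑-cong-∈ is λ i i∈ → ≈-trans
                   (*-congʳ (reflexive (⟦⟧-false (a ≟ i) (All.lookup a∉ i∈)))) (zeroˡ _)) ⟩
    f a + (∑[ i ∈ is ] 0#) ≈⟨ +-congˡ (∑-zero is) ⟩
    f a + 0#               ≈⟨ +-identityʳ _ ⟩
    f a                    ∎
  ∑-single _≟_ {i ∷ is} {a} (there a∈) (i∉ ∷ u) f = begin
    ⟦ a ≟ i ⟧ * f i + (∑[ i ∈ is ] (⟦ a ≟ i ⟧ * f i))
      ≈⟨ +-cong (≈-trans (*-congʳ (reflexive (⟦⟧-false (a ≟ i) λ where refl → All.lookup i∉ a∈ refl)))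
                         (zeroˡ _))
                (∑-single _≟_ a∈ u f) ⟩
    0# + f a ≈⟨ +-identityˡ _ ⟩
    f a      ∎

  ∑-cartesianProduct : ∀ (is : List I) (js : List J) f →
    ∑ (cartesianProduct is js) f ≈ ∑[ i ∈ is ] (∑[ j ∈ js ] f (i , j))
  ∑-cartesianProduct []       js f = ≈-refl
  ∑-cartesianProduct (i ∷ is) js f = ≈-trans (∑-++ (map (i ,_) js) _ f)
    (+-cong (reflexive (∑-map (i ,_) js f)) (∑-cartesianProduct is js f))

  ∑-select : {I : Set} {P : I → Set} (P? : U.Decidable P) (irr : U.Irrelevant P) (is : List I) → ∀ f →
             ∑ (select P? irr is) (f ∘ proj₁) ≈ ∑[ i ∈ is ] (⟦ P? i ⟧ * f i)
  ∑-select P? irr []       f = ≈-refl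
  ∑-select P? irr (i ∷ is) f with P? i
  ... | yes _ = +-cong (≈-sym (*-identityˡ _)) (∑-select P? irr is f)
  ... | no  _ = ≈-trans (∑-select P? irr is f)
                  (≈-trans (≈-sym (+-identityˡ _)) (+-congʳ (≈-sym (zeroˡ _))))

  ∏-cong-∈ : ∀ (is : List I) {f g} → (∀ i → i ∈ is → f i ≈ g i) → ∏ is f ≈ ∏ is g
  ∏-cong-∈ []       e = ≈-refl
  ∏-cong-∈ (i ∷ is) e = *-cong (e i (here refl)) (∏-cong-∈ is (λ j j∈ → e j (there j∈)))

  -- Each index raises exactly one exponent, the one at `h i`, because `vs` contains `h i` once.
  ∏-^-count : {V : Set} (_≟_ : DecidableEquality V) → ∀ {vs} → (∀ v → v ∈ vs) → Unique vs →
    ∀ (h : I → V) (s : V → Carrier) (is : List I) →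
    ∏ is (s ∘ h) ≈ ∏ vs (λ v → s v ^ length (filter (λ i → h i ≟ v) is))
  ∏-^-count _≟_ {vs} all u h s [] = ≈-sym (ones vs)
    where
    ones : ∀ vs → ∏ vs (λ _ → 1#) ≈ 1#
    ones []       = ≈-refl
    ones (v ∷ vs) = ≈-trans (*-identityˡ _) (ones vs)
  ∏-^-count _≟_ {vs} all u h s (i ∷ is) =
    ≈-trans (*-congˡ (∏-^-count _≟_ all u h s is)) (insert (all (h i)) u)
    where
    count : List _ → _ → ℕ
    count is v = length (filter (λ i → h i ≟ v) is)
    insert : ∀ {vs} → h i ∈ vs → Unique vs →
             s (h i) * ∏ vs (λ v → s v ^ count is v) ≈ ∏ vs (λ v → s v ^ count (i ∷ is) v)
    insert {v ∷ vs} (here refl) (v∉ ∷ u) = ≈-trans (≈-sym (*-assoc _ _ _)) (*-cong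
      (reflexive (≡.cong (λ js → s v ^ length js) (≡.sym (filter-accept (λ i → h i ≟ v) {i} {is} refl))))
      (∏-cong-∈ vs λ w w∈ → reflexive (≡.cong (λ js → s w ^ length js)
        (≡.sym (filter-reject (λ i → h i ≟ w) {i} {is} (All.lookup v∉ w∈))))))
    insert {v ∷ vs} (there i∈) (v∉ ∷ u) = ≈-trans (*-left-comm _ _ _) (*-cong
      (reflexive (≡.cong (λ js → s v ^ length js)
        (≡.sym (filter-reject (λ i → h i ≟ v) {i} {is} (All.lookup v∉ i∈ ∘ ≡.sym)))))
      (insert i∈ u))

  Row : Set → Set c
  Row C = List (Carrier × C)

  ⟨_∣_⟩ : {C : Set} → Row C → (C → Carrier) → Carrier
  ⟨ W ∣ φ ⟩ = ∑[ (w , c) ∈ W ] (w * φ c)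

  infix 4 _≋_
  -- Rows are formal linear combinations, equal when they define the same functional. Equality of
  -- lists would be too strict: the same row is enumerated in different orders.
  _≋_ : {C : Set} → Row C → Row C → Set _
  W ≋ W′ = ∀ φ → ⟨ W ∣ φ ⟩ ≈ ⟨ W′ ∣ φ ⟩

  module _ {C : Set} (W : Row C) where

    row-cong : ∀ {φ ψ} → (∀ c → φ c ≈ ψ c) → ⟨ W ∣ φ ⟩ ≈ ⟨ W ∣ ψ ⟩
    row-cong e = ∑-cong W λ (w , c) → *-congˡ (e c)

    row-+ : ∀ φ ψ → ⟨ W ∣ (λ c → φ c + ψ c) ⟩ ≈ ⟨ W ∣ φ ⟩ + ⟨ W ∣ ψ ⟩
    row-+ φ ψ = ≈-trans (∑-cong W λ (w , c) → distribˡ w _ _) (∑-+ W _ _)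

    row-*ˡ : ∀ a φ → ⟨ W ∣ (λ c → a * φ c) ⟩ ≈ a * ⟨ W ∣ φ ⟩
    row-*ˡ a φ = ≈-trans (∑-cong W λ (w , c) → *-left-comm w a _) (∑-*ˡ W a _)

    row-*ʳ : ∀ a φ → ⟨ W ∣ (λ c → φ c * a) ⟩ ≈ ⟨ W ∣ φ ⟩ * a
    row-*ʳ a φ = ≈-trans (row-cong λ c → *-comm _ a) (≈-trans (row-*ˡ a φ) (*-comm a _))

    row-comm : ∀ {D : Set} (W′ : Row D) (φ : C → D → Carrier) →
               ⟨ W ∣ (λ c → ⟨ W′ ∣ (λ d → φ c d) ⟩) ⟩ ≈ ⟨ W′ ∣ (λ d → ⟨ W ∣ (λ c → φ c d) ⟩) ⟩
    row-comm W′ φ = begin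
      ∑[ (w , c) ∈ W ] (w * (∑[ (w′ , d) ∈ W′ ] (w′ * φ c d)))
        ≈⟨ ∑-cong W (λ (w , c) → ∑-*ˡ W′ w _) ⟨
      ∑[ (w , c) ∈ W ] (∑[ (w′ , d) ∈ W′ ] (w * (w′ * φ c d)))
        ≈⟨ ∑-comm W W′ _ ⟩
      ∑[ (w′ , d) ∈ W′ ] (∑[ (w , c) ∈ W ] (w * (w′ * φ c d)))
        ≈⟨ ∑-cong W′ (λ (w′ , d) → row-*ˡ w′ _) ⟩
      ∑[ (w′ , d) ∈ W′ ] (w′ * (∑[ (w , c) ∈ W ] (w * φ c d))) ∎

    row-map : ∀ {D : Set} (g : C → D) φ → ⟨ map (map₂ g) W ∣ φ ⟩ ≡ ⟨ W ∣ φ ∘ g ⟩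
    row-map g φ = ∑-map (map₂ g) W _

  row-unit : {C : Set} (c : C) → ∀ φ → ⟨ (1# , c) ∷ [] ∣ φ ⟩ ≈ φ c
  row-unit c φ = ≈-trans (+-identityʳ _) (*-identityˡ _)

  Extensional : {X C : Set} → ((X → C) → Carrier) → Set _
  Extensional k = ∀ {f g} → f ≗ g → k f ≈ k g

  module _ {X C : Set} (_≟_ : DecidableEquality X) where
    open Update {X} {_} {C} _≟_

    -- The sum of k over all maps obtained from f by choosing new values on xs, a
    -- value c at x having the weight that ρ x gives it.
    total : List X → (X → Row C) → ((X → C) → Carrier) → (X → C) → Carrier
    total []       ρ k f = k f
    total (x ∷ xs) ρ k f = ⟨ ρ x ∣ (λ c → total xs ρ k (f [ x ≔ c ])) ⟩

    total-ext : ∀ xs ρ {k} → Extensional k → Extensional (total xs ρ k)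
    total-ext []       ρ ext e = ext e
    total-ext (x ∷ xs) ρ ext e = row-cong (ρ x) λ c → total-ext xs ρ ext (update-cong x c e)

    total-cong : ∀ xs {ρ ρ′ k k′} → (∀ x → x ∈ xs → ρ x ≋ ρ′ x) → (∀ f → k f ≈ k′ f) →
                 ∀ f → total xs ρ k f ≈ total xs ρ′ k′ f
    total-cong []       r e f = e f
    total-cong (x ∷ xs) {ρ} r e f = ≈-trans
      (row-cong (ρ x) λ c → total-cong xs (λ y y∈ → r y (there y∈)) e (f [ x ≔ c ]))
      (r x (here refl) _)

    total-*ˡ : ∀ xs ρ a k f → total xs ρ (λ g → a * k g) f ≈ a * total xs ρ k f
    total-*ˡ []       ρ a k f = ≈-refl
    total-*ˡ (x ∷ xs) ρ a k f =
      ≈-trans (row-cong (ρ x) λ c → total-*ˡ xs ρ a k (f [ x ≔ c ])) (row-*ˡ (ρ x) a _)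

    total-++ : ∀ xs ys ρ k f → total (xs ++ ys) ρ k f ≈ total xs ρ (total ys ρ k) f
    total-++ []       ys ρ k f = ≈-refl
    total-++ (x ∷ xs) ys ρ k f = row-cong (ρ x) λ c → total-++ xs ys ρ k (f [ x ≔ c ])

    -- The content is the swap, where two finite sums are interchanged and two updates commute; the
    -- latter requires distinct points, hence `Unique`.
    total-↭ : ∀ {xs ys} → xs ↭ ys → Unique xs → ∀ ρ {k} → Extensional k →
              ∀ f → total xs ρ k f ≈ total ys ρ k f
    total-↭ ↭.refl u ρ ext f = ≈-refl
    total-↭ (↭.prep x p) (_ ∷ u) ρ ext f = row-cong (ρ x) λ c → total-↭ p u ρ ext (f [ x ≔ c ])
    total-↭ (↭.trans p q) u ρ ext f = ≈-trans (total-↭ p u ρ ext f)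
      (total-↭ q (↭ₛ.Unique-resp-↭ (≡.setoid X) (↭⇒↭ₛ p) u) ρ ext f)
    total-↭ {x ∷ y ∷ xs} {_ ∷ _ ∷ ys} (↭.swap x y p) ((x≢y ∷ _) ∷ _ ∷ u) ρ {k} ext f = begin
      ⟨ ρ x ∣ (λ c → ⟨ ρ y ∣ (λ d → total xs ρ k (f [ x ≔ c ] [ y ≔ d ])) ⟩) ⟩
        ≈⟨ row-comm (ρ x) (ρ y) _ ⟩
      ⟨ ρ y ∣ (λ d → ⟨ ρ x ∣ (λ c → total xs ρ k (f [ x ≔ c ] [ y ≔ d ])) ⟩) ⟩
        ≈⟨ row-cong (ρ y) (λ d → row-cong (ρ x) λ c →
             ≈-trans (total-↭ p u ρ ext _) (total-ext ys ρ ext (update-comm f x≢y))) ⟩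
      ⟨ ρ y ∣ (λ d → ⟨ ρ x ∣ (λ c → total ys ρ k (f [ y ≔ d ] [ x ≔ c ])) ⟩) ⟩ ∎

    total-unit : ∀ xs ρ {k} → Extensional k → ∀ f g → (∀ x → x ∈ xs → ρ x ≡ (1# , g x) ∷ []) →
                 (∀ x → x ∉ xs → g x ≡ f x) → total xs ρ k f ≈ k g
    total-unit []       ρ ext f g r e = ext λ x → ≡.sym (e x λ ())
    total-unit (x ∷ xs) ρ {k} ext f g r e rewrite r x (here refl) = ≈-trans
      (row-unit (g x) λ c → total xs ρ k (f [ x ≔ c ]))
      (total-unit xs ρ ext (f [ x ≔ g x ]) g (λ y y∈ → r y (there y∈)) λ y y∉ → case y ≟ x of λ where
        (yes refl) → ≡.sym (update-same f x (g x))
        (no y≢x)   → ≡.trans (e y λ where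
                                (here y≡x) → y≢x y≡x
                                (there y∈) → y∉ y∈)
                             (≡.sym (update-other f y≢x)))

  module _ {X Y C D : Set} (_≟_ : DecidableEquality X) (_≟′_ : DecidableEquality Y)
           {i : Y → X} (i-injective : Injective _≡_ _≡_ i) (g : C → D) where
    open Update

    -- The summand sees `f` only through `g ∘ f ∘ i`, so the choices can be pushed forward.
    -- Injectivity of `i` keeps an update at `i y` away from the other points of the image.
    total-map : ∀ ys ρ {k} → Extensional k → ∀ f →
                total _≟_ (map i ys) ρ (λ f → k (g ∘ f ∘ i)) f
                ≈ total _≟′_ ys (λ y → map (map₂ g) (ρ (i y))) k (g ∘ f ∘ i)
    total-map []       ρ ext f = ≈-refl
    total-map (y ∷ ys) ρ {k} ext f = begin
      ⟨ ρ (i y) ∣ (λ c → total _≟_ (map i ys) ρ (λ f → k (g ∘ f ∘ i)) (_[_≔_] _≟_ f (i y) c)) ⟩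
        ≈⟨ row-cong (ρ (i y)) (λ c → ≈-trans (total-map ys ρ ext _)
                                             (total-ext _≟′_ ys ρ′ ext (push c))) ⟩
      ⟨ ρ (i y) ∣ (λ c → total _≟′_ ys ρ′ k (_[_≔_] _≟′_ (g ∘ f ∘ i) y (g c))) ⟩
        ≡⟨ row-map (ρ (i y)) g _ ⟨
      ⟨ ρ′ y ∣ (λ c → total _≟′_ ys ρ′ k (_[_≔_] _≟′_ (g ∘ f ∘ i) y c)) ⟩ ∎
      where
      ρ′ = λ y → map (map₂ g) (ρ (i y))
      push : ∀ c → g ∘ _[_≔_] _≟_ f (i y) c ∘ i ≗ _[_≔_] _≟′_ (g ∘ f ∘ i) y (g c)
      push c z with z ≟′ y
      ... | yes refl = ≡.cong g (update-same _≟_ f (i y) c)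
      ... | no z≢y   = ≡.cong g (update-other _≟_ f (z≢y ∘ i-injective))

-- The row operation

∈-extract : ∀ {A : Set} {x : A} {xs} → x ∈ xs → ∃[ ys ] xs ↭ x ∷ ys
∈-extract x∈ with ys , zs , refl ← ∈-∃++ x∈ = ys ++ zs , shift _ ys zs

-- Moving both elements to the end makes their choices the innermost ones in `total`, taken with the
-- rest of the map already fixed.
∈-extract₂ : ∀ {A : Set} {x y : A} {xs} → x ≢ y → x ∈ xs → y ∈ xs → ∃[ zs ] xs ↭ zs ++ x ∷ y ∷ []
∈-extract₂ x≢y x∈ y∈ with ∈-extract x∈
... | ys , p with ∈-resp-↭ p y∈
...   | here y≡x = contradiction (≡.sym y≡x) x≢y
...   | there y∈ with zs , q ← ∈-extract y∈ =
        zs , ↭.trans p (↭.trans (↭.prep _ q) (++-comm (_ ∷ _ ∷ []) zs))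

module Exchange {c ℓ} (R : CommutativeSemiring c ℓ) {X : Set} (X-finite : Finite X) where
  open CommutativeSemiring R
    renaming (refl to ≈-refl; sym to ≈-sym; trans to ≈-trans)
  open Sums R
  open Finite X-finite
  open Update {X} {_} {Maybe X} _≟_
  open import Relation.Binary.Reasoning.Setoid setoid

  isTree : (X → Maybe X) → Carrier
  isTree f = ⟦ tree? X-finite f ⟧

  isTree-ext : Extensional isTree
  isTree-ext {f} {g} e = reflexive
    (⟦⟧-cong (tree? X-finite f) (tree? X-finite g) (tree-cong e) (tree-cong (≡.sym ∘ e)))

  -- The weight of everything but the root option; for a vertex of a loopless digraph this is the
  -- diagonal entry of the Laplacian.
  escaping : Row (Maybe X) → Carrier
  escaping W = ⟨ W ∣ maybe (λ _ → 1#) 0# ⟩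

  module _ {a b : X} (a≢b : a ≢ b) where

    module _ (f : X → Maybe X) where
      private
        N : X → Maybe X
        N = f [ a ≔ nothing ] [ b ≔ nothing ]

        at-a : ∀ y z → (f [ a ≔ y ] [ b ≔ z ]) a ≡ y
        at-a y z = ≡.trans (update-other (f [ a ≔ y ]) a≢b) (update-same f a y)

      open Reconnect _≟_ a≢b {N} (at-a nothing nothing) (update-same (f [ a ≔ nothing ]) b nothing)

      private
        reconnected : ∀ y z → Reconnects (f [ a ≔ y ] [ b ≔ z ]) y z
        reconnected y z = reconnects (at-a y z) (update-same (f [ a ≔ y ]) b z) λ x≢a x≢b →
          ≡.trans (≡.trans (update-other (f [ a ≔ y ]) x≢b) (update-other f x≢a))
                  (≡.sym (≡.trans (update-other (f [ a ≔ nothing ]) x≢b) (update-other f x≢a)))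

        hits? : ∀ y → Dec (Hits y)
        hits? = dec λ y → leads? X-finite N y a

        misses? : ∀ y → Dec (Misses y)
        misses? = dec λ y → ¬? (leads? X-finite N y a)

        T? : ∀ y z → Dec (Tree (f [ a ≔ y ] [ b ≔ z ]))
        T? y z = tree? X-finite (f [ a ≔ y ] [ b ≔ z ])

        T : Maybe X → Maybe X → Carrier
        T y z = ⟦ T? y z ⟧

      -- If z leads back to a, swapping the roles of a and b turns (a → y, b → z) into
      -- (a → b, b → y); otherwise a may be redirected to b without harm.
      isTree-split : ∀ y z → T y z ≈ ⟦ hits? z ⟧ * T (just b) y + ⟦ misses? y ⟧ * T (just b) z
      isTree-split y z with hits? z
      ... | yes hit = begin
        T y z
          ≡⟨ ⟦⟧-cong (T? y z) (T? (just b) y)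
               (tree-exchange⁺ (reconnected y z) (reconnected (just b) y) hit)
               (tree-exchange⁻ (reconnected y z) (reconnected (just b) y) hit) ⟩
        T (just b) y
          ≈⟨ ≈-trans (+-cong (*-identityˡ _) (zeroʳ _)) (+-identityʳ _) ⟨
        1# * T (just b) y + ⟦ misses? y ⟧ * 0#
          ≡⟨ ≡.cong (λ t → 1# * T (just b) y + ⟦ misses? y ⟧ * t)
               (⟦⟧-false (T? (just b) z) (hit⇒¬tree (reconnected (just b) z) hit)) ⟨
        1# * T (just b) y + ⟦ misses? y ⟧ * T (just b) z ∎
      ... | no ¬hit = ≈-trans redirect (≈-sym (≈-trans (+-congʳ (zeroˡ _)) (+-identityˡ _)))
        where
        redirect : T y z ≈ ⟦ misses? y ⟧ * T (just b) z
        redirect with misses? y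
        ... | yes miss = ≈-trans
          (reflexive (⟦⟧-cong (T? y z) (T? (just b) z)
            (λ t → let _ , t′ = tree-redirect⁺ (reconnected y z) (reconnected (just b) z) ¬hit t in t′)
            (tree-redirect⁻ (reconnected y z) (reconnected (just b) z) ¬hit miss)))
          (≈-sym (*-identityˡ _))
        ... | no ¬miss = ≈-trans
          (reflexive (⟦⟧-false (T? y z)
            λ t → let miss , _ = tree-redirect⁺ (reconnected y z) (reconnected (just b) z) ¬hit t in ¬miss miss))
          (≈-sym (zeroˡ _))

      hits+misses : ∀ y → ⟦ hits? y ⟧ + ⟦ misses? y ⟧ ≈ maybe (λ _ → 1#) 0# y
      hits+misses nothing  = +-identityˡ 0#
      hits+misses (just y) = ⟦⟧-complement (leads? X-finite N y a)

      -- `isTree-split` separates the variables in each term, and as both run over `W`, the factor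
      -- left after summation is the same in the two terms. The indicators `hits` and `misses` add
      -- up to 1 on every vertex and to 0 on `nothing`, which gives `escaping W`.
      row-exchange : ∀ (W : Row (Maybe X)) →
        ⟨ W ∣ (λ y → ⟨ W ∣ T y ⟩) ⟩ ≈ escaping W * ⟨ W ∣ T (just b) ⟩
      row-exchange W = begin
        ⟨ W ∣ (λ y → ⟨ W ∣ T y ⟩) ⟩
          ≈⟨ row-cong W (λ y → ≈-trans (row-cong W (isTree-split y)) (≈-trans (row-+ W _ _)
               (+-cong (row-*ʳ W (G y) _) (row-*ˡ W (⟦ misses? y ⟧) _)))) ⟩
        ⟨ W ∣ (λ y → ⟨ W ∣ hits ⟩ * G y + misses y * ⟨ W ∣ G ⟩) ⟩
          ≈⟨ ≈-trans (row-+ W _ _) (+-cong (row-*ˡ W _ _) (row-*ʳ W _ _)) ⟩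
        ⟨ W ∣ hits ⟩ * ⟨ W ∣ G ⟩ + ⟨ W ∣ misses ⟩ * ⟨ W ∣ G ⟩
          ≈⟨ distribʳ _ _ _ ⟨
        (⟨ W ∣ hits ⟩ + ⟨ W ∣ misses ⟩) * ⟨ W ∣ G ⟩
          ≈⟨ *-congʳ (≈-trans (≈-sym (row-+ W _ _)) (row-cong W hits+misses)) ⟩
        escaping W * ⟨ W ∣ G ⟩ ∎
        where
        G hits misses : Maybe X → Carrier
        G      = T (just b)
        hits   = λ z → ⟦ hits? z ⟧
        misses = λ y → ⟦ misses? y ⟧

    -- The combinatorial form of a row operation on the Laplacian: when row a is row b plus
    -- α at b, row a may be replaced by a single entry at b.
    total-exchange : ∀ {xs} → Unique xs → a ∈ xs → b ∈ xs → ∀ {ρ ρ′ : X → Row (Maybe X)} α →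
      ρ a ≋ (α , just b) ∷ ρ b → ρ′ a ≋ (1# , just b) ∷ [] → (∀ x → x ≢ a → ρ x ≡ ρ′ x) →
      ∀ f → total _≟_ xs ρ isTree f ≈ (α + escaping (ρ b)) * total _≟_ xs ρ′ isTree f
    total-exchange {xs} u a∈ b∈ {ρ} {ρ′} α ρa ρ′a off f with ∈-extract₂ a≢b a∈ b∈
    ... | ys , p = begin
      total _≟_ xs ρ isTree f
        ≈⟨ ≈-trans (total-↭ _≟_ p u ρ isTree-ext f) (total-++ _≟_ ys ab ρ isTree f) ⟩
      total _≟_ ys ρ (total _≟_ ab ρ isTree) f
        ≈⟨ total-cong _≟_ ys (λ x x∈ φ → reflexive (≡.cong (λ W → ⟨ W ∣ φ ⟩) (off x (x≢a x∈)))) inner f ⟩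
      total _≟_ ys ρ′ (λ g → s * total _≟_ ab ρ′ isTree g) f
        ≈⟨ total-*ˡ _≟_ ys ρ′ s _ f ⟩
      s * total _≟_ ys ρ′ (total _≟_ ab ρ′ isTree) f
        ≈⟨ *-congˡ (≈-trans (total-↭ _≟_ p u ρ′ isTree-ext f) (total-++ _≟_ ys ab ρ′ isTree f)) ⟨
      s * total _≟_ xs ρ′ isTree f ∎
      where
      s  = α + escaping (ρ b)
      ab = a ∷ b ∷ []
      x≢a : ∀ {x} → x ∈ ys → x ≢ a
      x≢a x∈ refl = separated ys (↭ₛ.Unique-resp-↭ (≡.setoid X) (↭⇒↭ₛ p) u) x∈
        where
        separated : ∀ ys → Unique (ys ++ ab) → a ∈ ys → _
        separated (y ∷ ys) (y∉ ∷ _) (here refl) = All.lookup y∉ (∈-insert ys) refl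
        separated (y ∷ ys) (_ ∷ u) (there a∈)   = separated ys u a∈
      inner : ∀ g → total _≟_ ab ρ isTree g ≈ s * total _≟_ ab ρ′ isTree g
      inner g = begin
        ⟨ ρ a ∣ Φ ⟩
          ≈⟨ ρa Φ ⟩
        -- The extra entry already sends `a` to `b`; the copy of row `b` is the double sum of
        -- `row-exchange`. Both are multiples of `Φ (just b)`.
        α * Φ (just b) + ⟨ ρ b ∣ Φ ⟩
          ≈⟨ +-congˡ (row-exchange g (ρ b)) ⟩
        α * Φ (just b) + escaping (ρ b) * Φ (just b)
          ≈⟨ distribʳ _ _ _ ⟨
        s * Φ (just b)
          ≡⟨ ≡.cong (λ W → s * ⟨ W ∣ (λ z → isTree (g [ a ≔ just b ] [ b ≔ z ])) ⟩) (off b (a≢b ∘ ≡.sym)) ⟩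
        s * ⟨ ρ′ b ∣ (λ z → isTree (g [ a ≔ just b ] [ b ≔ z ])) ⟩
          ≈⟨ *-congˡ (≈-trans (ρ′a _) (row-unit (just b) λ y → ⟨ ρ′ b ∣ (λ z → isTree (g [ a ≔ y ] [ b ≔ z ])) ⟩)) ⟨
        s * total _≟_ ab ρ′ isTree g ∎
        where
        Φ = λ y → ⟨ ρ b ∣ (λ z → isTree (g [ a ≔ y ] [ b ≔ z ])) ⟩

-- Spanning trees as parent maps

-- With the arcs listed tail by tail, a sum over arc sets can be turned into successive choices, one
-- vertex at a time.
group-↭ : ∀ {I V : Set} (_≟_ : DecidableEquality V) (t : I → V) {vs} → (∀ v → v ∈ vs) → Unique vs →
          ∀ is → is ↭ concatMap (λ v → filter (λ i → t i ≟ v) is) vs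
group-↭ {I} _≟_ t {vs} all u [] = ↭.↭-reflexive (≡.sym (empty vs))
  where
  empty : ∀ vs → concatMap {B = I} (λ _ → []) vs ≡ []
  empty []       = refl
  empty (_ ∷ vs) = empty vs
group-↭ {I} _≟_ t {vs} all u (i ∷ is) =
  ↭.trans (↭.prep i (group-↭ _≟_ t all u is)) (insert u (all (t i)))
  where
  class : List I → _ → List I
  class is v = filter (λ i → t i ≟ v) is
  unaffected : ∀ {vs} → t i ∉ vs → concatMap (class is) vs ↭ concatMap (class (i ∷ is)) vs
  unaffected {[]}     _  = ↭.refl
  unaffected {v ∷ vs} ∉vs rewrite filter-reject (λ i → t i ≟ v) {i} {is} (λ e → ∉vs (here e)) =
    ++⁺ˡ (class is v) (unaffected (∉vs ∘ there))
  insert : ∀ {vs} → Unique vs → t i ∈ vs →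
           i ∷ concatMap (class is) vs ↭ concatMap (class (i ∷ is)) vs
  insert {v ∷ vs} (v∉ ∷ _) (here refl) rewrite filter-accept (λ i → t i ≟ v) {i} {is} refl =
    ↭.prep i (++⁺ˡ (class is v) (unaffected λ v∈ → All.lookup v∉ v∈ refl))
  insert {v ∷ vs} (v∉ ∷ u) (there i∈)
    rewrite filter-reject (λ i → t i ≟ v) {i} {is} (All.lookup v∉ i∈ ∘ ≡.sym) =
    ↭.trans (↭.↭-sym (shift i (class is v) _)) (++⁺ˡ (class is v) (insert u i∈))

module _ (D : Digraph) where
  open Digraph D

  out : V → List A
  out v = filter (λ e → t e ≟ v) arcs

  spanningTree-↭ : ∀ {S T} → S ↭ T → IsSpanningTree S → IsSpanningTree T
  spanningTree-↭ {S} {T} p (conn , acyc , r , root , others) =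
    (λ u v → Eq.map (Any-resp-↭ p) (conn u v)) ,
    (λ v c → acyc v (map⁺ c)) ,
    r , ≡.trans (degree r) root , λ v v≢r → ≡.trans (degree v) (others v v≢r)
    where
    map⁺ : ∀ {u v} → TransClosure (ArcIn T) u v → TransClosure (ArcIn S) u v
    map⁺ [ a ]   = [ Any-resp-↭ (↭.↭-sym p) a ]
    map⁺ (a ∷ c) = Any-resp-↭ (↭.↭-sym p) a ∷ map⁺ c
    degree : ∀ v → outdegree T v ≡ outdegree S v
    degree v = ↭-length (filter-↭ (λ e → t e ≟ v) (↭.↭-sym p))

  -- The common tail has outdegree at least 2, while the root has 0 and every other vertex 1.
  ¬spanningTree-branching : ∀ {e e′ S} → t e ≡ t e′ → e′ ∈ S → ¬ IsSpanningTree (e ∷ S)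
  ¬spanningTree-branching {e} {e′} {S} te≡ e′∈ (_ , _ , r , root , others) with t e ≟ r
  ... | yes refl = case root of λ ()
  ... | no te≢r
    with filter (λ f → t f ≟ t e) S | ∈-filter⁺ (λ f → t f ≟ t e) e′∈ (≡.sym te≡)
       | ≡.trans (≡.sym (≡.cong length (filter-accept (λ f → t f ≟ t e) {e} {S} refl))) (others (t e) te≢r)
  ...   | []    | () | _
  ...   | _ ∷ _ | _  | ()

  -- f picks at most one outgoing arc at each vertex, and S lists the picked arcs.
  Represents : List A → (V → Maybe A) → Set
  Represents S f = ∀ v → filter (λ e → t e ≟ v) S ≡ fromMaybe (f v)

  module _ {S f} (S≈f : Represents S f) where
    private
      next : V → Maybe V
      next = Maybe.map h ∘ f

      degree : ∀ v → outdegree S v ≡ length (fromMaybe (f v))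
      degree v = ≡.cong length (S≈f v)

      arc⇒next : ∀ {u v} → ArcIn S u v → Next next u v
      arc⇒next {u} a with find a
      ... | e , e∈ , refl , refl with f u | ≡.subst (e ∈_) (S≈f u) (∈-filter⁺ (λ e → t e ≟ u) e∈ refl)
      ...   | just _ | here refl = refl

      next⇒arc : ∀ {u v} → Next next u v → ArcIn S u v
      next⇒arc {u} p with f u | S≈f u
      next⇒arc {u} refl | just e | S≈f-u
        with e∈ , te≡u ← ∈-filter⁻ (λ e → t e ≟ u) {xs = S} (≡.subst (e ∈_) (≡.sym S≈f-u) (here refl))
        = lose e∈ (te≡u , refl)

    spanningTree⇒tree : IsSpanningTree S → Tree next
    spanningTree⇒tree (conn , _ , r , root , _) = r , λ x → along (conn x r) (stop next-r)
      where
      next-r : next r ≡ nothing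
      next-r with f r | ≡.trans (≡.sym (degree r)) root
      ... | nothing | _ = refl
      along : ∀ {x y} → Eq.EqClosure (ArcIn S) x y → Leads next y r → Leads next x r
      along ε           l = l
      along (fwd a ◅ s) l = step (arc⇒next a) (along s l)
      -- The arc is traversed against its direction: its tail leads to `r`, and since `next` is
      -- single-valued that walk passes through the head `x`.
      along (bwd a ◅ s) l = leads-tail (arc⇒next a) (along s l)

    tree⇒spanningTree : Tree next → IsSpanningTree S
    tree⇒spanningTree (r , l) =
      (λ u v → upwards (l u) ◅◅ Eq.symmetric _ (upwards (l v))) ,
      (λ v c → leads-acyclic (l v) (map⁺ c)) ,
      r , root , others
      where
      upwards : ∀ {x} → Leads next x r → Eq.EqClosure (ArcIn S) x r
      upwards (stop _)   = ε
      upwards (step p l) = fwd (next⇒arc p) ◅ upwards l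
      map⁺ : ∀ {u v} → TransClosure (ArcIn S) u v → TransClosure (Next next) u v
      map⁺ [ a ]   = [ arc⇒next a ]
      map⁺ (a ∷ c) = arc⇒next a ∷ map⁺ c
      root : outdegree S r ≡ 0
      root with f r | leads-end (l r) | degree r
      ... | nothing | _ | p = p
      others : ∀ v → v ≢ r → outdegree S v ≡ 1
      others v v≢r with f v in eq | degree v
      ... | just _  | p = p
      ... | nothing | _ = contradiction (leads-unique (stop (≡.cong (Maybe.map h) eq)) (l v)) v≢r

module SpanningTrees {c ℓ} (R : CommutativeSemiring c ℓ) (D : Digraph) where
  open CommutativeSemiring R
    renaming (refl to ≈-refl; sym to ≈-sym; trans to ≈-trans)
  open Sums R
  open Digraph D
  open Finite V-finite using (complete; unique)
  open Exchange R V-finite using (isTree; isTree-ext)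
  open Update {V} {_} {Maybe A} _≟_
  open import Relation.Binary.Reasoning.Setoid setoid
  open import Algebra.Properties.CommutativeSemigroup +-commutativeSemigroup
    using () renaming (interchange to +-interchange)
  open import Algebra.Properties.CommutativeSemigroup *-commutativeSemigroup
    using () renaming (x∙yz≈y∙xz to *-left-comm)

  module _ (χ : A → Carrier) where

    -- The weighted sum over sublists with the test function as a continuation. In this form,
    -- permuting the arcs, discarding some, or committing to one are inductions on `es`, without
    -- reordering `sublists`.
    subtotal : List A → (List A → Carrier) → Carrier
    subtotal []       φ = φ []
    subtotal (e ∷ es) φ = χ e * subtotal es (φ ∘ (e ∷_)) + subtotal es φ

    ∑-sublists : ∀ es φ → ∑[ S ∈ sublists es ] (∏ S χ * φ S) ≈ subtotal es φ
    ∑-sublists []       φ = ≈-trans (+-identityʳ _) (*-identityˡ _)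
    ∑-sublists (e ∷ es) φ = begin
      ∑ (map (e ∷_) (sublists es) ++ sublists es) (λ S → ∏ S χ * φ S)
        ≈⟨ ∑-++ (map (e ∷_) (sublists es)) _ _ ⟩
      ∑ (map (e ∷_) (sublists es)) (λ S → ∏ S χ * φ S) + ∑ (sublists es) (λ S → ∏ S χ * φ S)
        ≈⟨ +-cong (reflexive (∑-map (e ∷_) (sublists es) _)) (∑-sublists es φ) ⟩
      ∑ (sublists es) (λ S → (χ e * ∏ S χ) * φ (e ∷ S)) + subtotal es φ
        ≈⟨ +-congʳ (≈-trans (∑-cong (sublists es) λ S → *-assoc _ _ _) (∑-*ˡ (sublists es) _ _)) ⟩
      χ e * ∑ (sublists es) (λ S → ∏ S χ * φ (e ∷ S)) + subtotal es φ
        ≈⟨ +-congʳ (*-congˡ (∑-sublists es (φ ∘ (e ∷_)))) ⟩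
      subtotal (e ∷ es) φ ∎

    Symmetric : (List A → Carrier) → Set _
    Symmetric φ = ∀ {S T} → S ↭ T → φ S ≈ φ T

    subtotal-cong : ∀ es {φ ψ} → (∀ S → φ S ≈ ψ S) → subtotal es φ ≈ subtotal es ψ
    subtotal-cong []       p = p []
    subtotal-cong (e ∷ es) p =
      +-cong (*-congˡ (subtotal-cong es λ S → p (e ∷ S))) (subtotal-cong es p)

    subtotal-zero : ∀ es {φ} → (∀ S → φ S ≈ 0#) → subtotal es φ ≈ 0#
    subtotal-zero []       p = p []
    subtotal-zero (e ∷ es) p = ≈-trans
      (+-cong (≈-trans (*-congˡ (subtotal-zero es λ S → p (e ∷ S))) (zeroʳ _)) (subtotal-zero es p))
      (+-identityˡ _)

    subtotal-↭ : ∀ {es fs} → es ↭ fs → ∀ {φ} → Symmetric φ → subtotal es φ ≈ subtotal fs φ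
    subtotal-↭ ↭.refl        φ-sym = ≈-refl
    subtotal-↭ (↭.prep e p)  φ-sym =
      +-cong (*-congˡ (subtotal-↭ p (φ-sym ∘ ↭.prep e))) (subtotal-↭ p φ-sym)
    subtotal-↭ (↭.trans p q) φ-sym = ≈-trans (subtotal-↭ p φ-sym) (subtotal-↭ q φ-sym)
    subtotal-↭ {_ ∷ _ ∷ es} {_ ∷ _ ∷ fs} (↭.swap e f p) {φ} φ-sym = begin
      χ e * (χ f * Σef + Σe) + (χ f * subtotal es (φ ∘ (f ∷_)) + subtotal es φ)
        ≈⟨ +-cong (distribˡ _ _ _) ≈-refl ⟩
      (χ e * (χ f * Σef) + χ e * Σe) + (χ f * subtotal es (φ ∘ (f ∷_)) + subtotal es φ)
        ≈⟨ +-interchange _ _ _ _ ⟩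
      (χ e * (χ f * Σef) + χ f * subtotal es (φ ∘ (f ∷_))) + (χ e * Σe + subtotal es φ)
        ≈⟨ +-congʳ (≈-trans (+-congʳ (*-left-comm _ _ _)) (≈-sym (distribˡ _ _ _))) ⟩
      χ f * (χ e * Σef + subtotal es (φ ∘ (f ∷_))) + (χ e * Σe + subtotal es φ)
        ≈⟨ +-cong (*-congˡ (+-cong (*-congˡ (≈-trans
                    (subtotal-cong es λ S → φ-sym (↭.swap e f ↭.refl))
                    (subtotal-↭ p (φ-sym ∘ ↭.prep f ∘ ↭.prep e))))
                  (subtotal-↭ p (φ-sym ∘ ↭.prep f))))
                (+-cong (*-congˡ (subtotal-↭ p (φ-sym ∘ ↭.prep e))) (subtotal-↭ p φ-sym)) ⟩
      subtotal (f ∷ e ∷ fs) φ ∎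
      where
      Σef Σe : Carrier
      Σef = subtotal es (φ ∘ (e ∷_) ∘ (f ∷_))
      Σe  = subtotal es (φ ∘ (e ∷_))

    choices : List A → Row (Maybe A)
    choices es = (1# , nothing) ∷ map (λ e → χ e , just e) es

    subtotal-drop : ∀ es {fs φ} → (∀ {e S} → e ∈ es → e ∈ S → φ S ≈ 0#) →
                    subtotal (es ++ fs) φ ≈ subtotal fs φ
    subtotal-drop []       φ0 = ≈-refl
    subtotal-drop (e ∷ es) {fs} φ0 = ≈-trans
      (+-cong (≈-trans (*-congˡ (subtotal-zero (es ++ fs) λ S → φ0 (here refl) (here refl))) (zeroʳ _))
              (subtotal-drop es (φ0 ∘ there)))
      (+-identityˡ _)

    -- Once an arc of `es` is taken, every term with a second one vanishes, so `subtotal-drop` skips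
    -- the remaining arcs of `es`.
    subtotal-choose : ∀ es {fs φ} → (∀ {e f S} → e ∈ es → f ∈ es → f ∈ S → φ (e ∷ S) ≈ 0#) →
      subtotal (es ++ fs) φ ≈ ⟨ choices es ∣ (λ c → subtotal fs (λ S → φ (fromMaybe c ++ S))) ⟩
    subtotal-choose es {fs} {φ} φ0 = ≈-trans (go es φ0)
      -- The recursion reaches the option of taking no arc last, whereas `choices` lists it first.
      (≈-trans (+-comm _ _) (+-congʳ (≈-sym (*-identityˡ _))))
      where
      go : ∀ es → (∀ {e f S} → e ∈ es → f ∈ es → f ∈ S → φ (e ∷ S) ≈ 0#) → subtotal (es ++ fs) φ ≈
           ⟨ map (λ e → χ e , just e) es ∣ (λ c → subtotal fs (λ S → φ (fromMaybe c ++ S))) ⟩ + subtotal fs φ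
      go []       φ0 = ≈-sym (+-identityˡ _)
      go (e ∷ es) φ0 = ≈-trans
        (+-cong (*-congˡ (subtotal-drop es λ f∈ → φ0 (here refl) (there f∈)))
                (go es λ e∈ f∈ → φ0 (there e∈) (there f∈)))
        (≈-sym (+-assoc _ _ _))

    module _ {φ} (φ-sym : Symmetric φ) (φ-sparse : ∀ {e f S} → t e ≡ t f → f ∈ S → φ (e ∷ S) ≈ 0#)
             {K} (K-ext : Extensional K) (φ≈K : ∀ {S f} → Represents D S f → φ S ≈ K f) where

      -- `S` and `f` record the same partial choice, once as a list of arcs and once as a map. The
      -- vertices still in `vs` have no value in `f`, hence no outgoing arc in `S`, which is what
      -- allows the next choice to extend both.
      subtotal⇒total : ∀ {vs} → Unique vs → ∀ S {f} → Represents D S f → (∀ {v} → v ∈ vs → f v ≡ nothing) →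
        subtotal (concatMap (out D) vs) (λ T → φ (S ++ T)) ≈ total _≟_ vs (choices ∘ out D) K f
      subtotal⇒total {[]}     _        S rep fresh rewrite ++-identityʳ S = φ≈K rep
      subtotal⇒total {v ∷ vs} (v∉ ∷ u) S {f} rep fresh = ≈-trans
        (subtotal-choose (out D v) λ {e} {_} {T} e∈ f∈ f∈T → ≈-trans (φ-sym (shift e S T))
          (φ-sparse (≡.trans (tail e∈) (≡.sym (tail f∈))) (∈-++⁺ʳ S f∈T)))
        (∑-cong-∈ (choices (out D v)) λ where
          (_ , c) c∈ → *-congˡ (≈-trans
            (subtotal-cong (concatMap (out D) vs) λ T →
              reflexive (≡.cong φ (≡.sym (++-assoc S (fromMaybe c) T))))
            (subtotal⇒total u (S ++ fromMaybe c) (extend c c∈) λ w∈ →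
              ≡.trans (update-other f (λ where refl → All.lookup v∉ w∈ refl)) (fresh (there w∈)))))
        where
        tail : ∀ {e} → e ∈ out D v → t e ≡ v
        tail e∈ = proj₂ (∈-filter⁻ (λ e → t e ≟ v) {xs = arcs} e∈)
        extend : ∀ {w} c → (w , c) ∈ choices (out D v) → Represents D (S ++ fromMaybe c) (f [ v ≔ c ])
        extend nothing c∈ w rewrite ++-identityʳ S with w ≟ v
        ... | yes refl = ≡.trans (rep v) (≡.cong fromMaybe (fresh (here refl)))
        ... | no  _    = rep w
        extend (just e) (there c∈) w with _ , e∈ , refl ← ∈-map⁻ _ c∈ | w ≟ v
        ... | yes refl rewrite filter-++ (λ e → t e ≟ v) S (e ∷ []) | rep v | fresh (here refl)
                | filter-accept (λ e → t e ≟ v) {e} {[]} (tail e∈) = refl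
        ... | no w≢v   rewrite filter-++ (λ e → t e ≟ w) S (e ∷ [])
                | filter-reject (λ e → t e ≟ w) {e} {[]} (λ te≡w → w≢v (≡.trans (≡.sym te≡w) (tail e∈)))
                | ++-identityʳ (filter (λ e → t e ≟ w) S) = rep w

    treeRow : V → Row (Maybe V)
    treeRow v = map (map₂ (Maybe.map h)) (choices (out D v))

    ∑-spanningTrees : ∑[ T ∈ spanningTrees ] ∏ T χ ≈ total _≟_ vertices treeRow isTree (const nothing)
    ∑-spanningTrees = begin
      ∑[ T ∈ spanningTrees ] ∏ T χ
        ≈⟨ ∑-filter isSpanningTree? (sublists arcs) _ ⟩
      ∑[ S ∈ sublists arcs ] (φ S * ∏ S χ)
        ≈⟨ ∑-cong (sublists arcs) (λ S → *-comm _ _) ⟩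
      ∑[ S ∈ sublists arcs ] (∏ S χ * φ S)
        ≈⟨ ∑-sublists arcs φ ⟩
      subtotal arcs φ
        ≈⟨ subtotal-↭ (group-↭ _≟_ t complete unique arcs) φ-sym ⟩
      subtotal (concatMap (out D) vertices) φ
        ≈⟨ subtotal⇒total φ-sym φ-sparse {K} K-ext φ≈K unique [] (λ _ → refl) (λ _ → refl) ⟩
      total _≟_ vertices (choices ∘ out D) K (const nothing)
        ≡⟨ ≡.cong (λ vs → total _≟_ vs (choices ∘ out D) K (const nothing)) (map-id vertices) ⟨
      -- `total-map` is used with the identity on vertices: only the values change, from arcs to
      -- their heads.
      total _≟_ (map id vertices) (choices ∘ out D) K (const nothing)
        ≈⟨ total-map _≟_ _≟_ id (Maybe.map h) vertices (choices ∘ out D) isTree-ext (const nothing) ⟩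
      total _≟_ vertices treeRow isTree (const nothing) ∎
      where
      φ : List A → Carrier
      φ S = ⟦ isSpanningTree? S ⟧
      K : (V → Maybe A) → Carrier
      K f = isTree (Maybe.map h ∘ f)
      φ-sym : Symmetric φ
      φ-sym {S} {T} p = reflexive (⟦⟧-cong (isSpanningTree? S) (isSpanningTree? T)
        (spanningTree-↭ D p) (spanningTree-↭ D (↭.↭-sym p)))
      φ-sparse : ∀ {e f S} → t e ≡ t f → f ∈ S → φ (e ∷ S) ≈ 0#
      φ-sparse {e} {f} {S} te≡tf f∈ = reflexive (⟦⟧-false (isSpanningTree? (e ∷ S))
        (¬spanningTree-branching D {e} {f} te≡tf f∈))
      K-ext : Extensional K
      K-ext p = isTree-ext (≡.cong (Maybe.map h) ∘ p)
      φ≈K : ∀ {S f} → Represents D S f → φ S ≈ K f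
      φ≈K {S} {f} rep = reflexive (⟦⟧-cong (isSpanningTree? S) (tree? V-finite (Maybe.map h ∘ f))
        (spanningTree⇒tree D rep) (tree⇒spanningTree D rep))

  -- The arcs are selected from all pairs of vertices by `_⟶?_`, so fixing the tail leaves a sum
  -- over possible heads. For the middle digraph this reduces its rows to `MiddleArc`.
  ∑-out : ∀ v (g : V → Carrier) → ∑ (out D v) (g ∘ h) ≈ ∑[ w ∈ vertices ] (⟦ v ⟶? w ⟧ * g w)
  ∑-out v g = begin
    ∑ (out D v) (g ∘ h)
      ≈⟨ ∑-filter (λ e → t e ≟ v) arcs _ ⟩
    ∑[ e ∈ arcs ] (⟦ t e ≟ v ⟧ * g (h e))
      ≈⟨ ∑-select (uncurry _⟶?_) ⟶-irrelevant (cartesianProduct vertices vertices) (λ (u , w) → ⟦ u ≟ v ⟧ * g w) ⟩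
    ∑ (cartesianProduct vertices vertices) (λ (u , w) → ⟦ u ⟶? w ⟧ * (⟦ u ≟ v ⟧ * g w))
      ≈⟨ ∑-cartesianProduct vertices vertices _ ⟩
    ∑[ u ∈ vertices ] (∑[ w ∈ vertices ] (⟦ u ⟶? w ⟧ * (⟦ u ≟ v ⟧ * g w)))
      ≈⟨ ∑-cong vertices (λ u → ≈-trans (∑-cong vertices λ w → *-left-comm _ _ _) (∑-*ˡ vertices _ _)) ⟩
    ∑[ u ∈ vertices ] (⟦ u ≟ v ⟧ * (∑[ w ∈ vertices ] (⟦ u ⟶? w ⟧ * g w)))
      ≈⟨ ∑-cong vertices (λ u → *-congʳ (reflexive (⟦⟧-cong (u ≟ v) (v ≟ u) ≡.sym ≡.sym))) ⟩
    ∑[ u ∈ vertices ] (⟦ v ≟ u ⟧ * (∑[ w ∈ vertices ] (⟦ u ⟶? w ⟧ * g w)))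
      ≈⟨ ∑-single _≟_ (complete v) unique _ ⟩
    ∑[ w ∈ vertices ] (⟦ v ⟶? w ⟧ * g w) ∎

-- The middle digraph

module _ {V A : Set} {h : A → V} {F : V ⊎ A → Maybe (V ⊎ A)} (F-inj₂ : ∀ e → F (inj₂ e) ≡ just (inj₁ (h e))) where
  private
    contract : V ⊎ A → V
    contract = Sum.[ id , h ]

    G : V → Maybe V
    G = Maybe.map contract ∘ F ∘ inj₁

    -- An arc is never a root, and its forced step to its head is invisible after `contract`; such
    -- steps disappear from the walk, and the others become steps of `G`.
    contract-leads : ∀ {x r} → Leads F x r → ∃[ s ] r ≡ inj₁ s × Leads G (contract x) s
    contract-leads {inj₁ v} (stop p) = v , refl , stop (≡.cong (Maybe.map contract) p)
    contract-leads {inj₂ e} (stop p) = case ≡.trans (≡.sym (F-inj₂ e)) p of λ ()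
    contract-leads {inj₁ v} (step p l) with s , refl , m ← contract-leads l =
      s , refl , step (≡.cong (Maybe.map contract) p) m
    contract-leads {inj₂ e} (step p l) with refl ← ≡.trans (≡.sym (F-inj₂ e)) p = contract-leads l

    expand-leads : ∀ {v r} → Leads G v r → Leads F (inj₁ v) (inj₁ r)
    expand-leads {v} (stop p) with F (inj₁ v) in eq
    ... | nothing = stop eq
    expand-leads {v} (step p l) with F (inj₁ v) in eq
    expand-leads {v} (step refl l) | just (inj₁ _) = step eq (expand-leads l)
    expand-leads {v} (step refl l) | just (inj₂ e) = step eq (step (F-inj₂ e) (expand-leads l))

  contract-tree : Tree F → Tree (Maybe.map Sum.[ id , h ] ∘ F ∘ inj₁)
  contract-tree (r , l) with s , refl , _ ← contract-leads (l r) = s , λ v →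
    case contract-leads (l (inj₁ v)) of λ where (_ , refl , m) → m

  expand-tree : Tree (Maybe.map Sum.[ id , h ] ∘ F ∘ inj₁) → Tree F
  expand-tree (r , l) = inj₁ r , λ where
    (inj₁ v) → expand-leads (l v)
    (inj₂ e) → step (F-inj₂ e) (expand-leads (l (h e)))

module Middle {c ℓ} (R : CommutativeSemiring c ℓ) (D : Digraph) where
  open CommutativeSemiring R
    renaming (refl to ≈-refl; sym to ≈-sym; trans to ≈-trans)
  open Sums R
  open Digraph D
  open Finite V-finite using (complete; unique)
  open Finite A-finite using () renaming (_≟_ to _≟ᴬ_; complete to arcs-complete; unique to arcs-unique)
  private module 𝓜 = Digraph (M D)
  open Finite 𝓜.V-finite using () renaming (complete to 𝓜-complete; unique to 𝓜-unique)
  open Exchange R 𝓜.V-finite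
  private module E = Exchange R V-finite
  open SpanningTrees R using (treeRow; ∑-out; ∑-spanningTrees)
  open import Relation.Binary.Reasoning.Setoid setoid

  module _ (χ : V ⊎ A → Carrier) where

    -- The row of an arc is literally the row of its head with one entry in front, the shape
    -- required by `total-exchange`.
    middleRow : V ⊎ A → Row (Maybe (V ⊎ A))
    middleRow (inj₁ v) = (1# , nothing) ∷ map (λ e → χ (inj₂ e) , just (inj₂ e)) (out D v)
    middleRow (inj₂ e) = (χ (inj₁ (h e)) , just (inj₁ (h e))) ∷ middleRow (inj₁ (h e))

    ∑-middle : ∀ x g → ∑ (out (M D) x) (g ∘ 𝓜.h) ≈
      ∑ vertices (λ v → ⟦ middleArc? D x (inj₁ v) ⟧ * g (inj₁ v)) +
      ∑ arcs (λ e → ⟦ middleArc? D x (inj₂ e) ⟧ * g (inj₂ e))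
    ∑-middle x g = ≈-trans (∑-out (M D) x g) (≈-trans (∑-++ (map inj₁ vertices) _ _)
      (+-cong (reflexive (∑-map inj₁ vertices _)) (reflexive (∑-map inj₂ arcs _))))

    treeRow-middle : ∀ x → treeRow (M D) (χ ∘ 𝓜.h) x ≋ middleRow x
    treeRow-middle x φ = ≈-trans (+-congˡ (≈-trans
        (reflexive (≡.trans (∑-map (map₂ (Maybe.map 𝓜.h)) (map _ (out (M D) x)) _) (∑-map _ (out (M D) x) _)))
        (∑-middle x g)))
      (rows x)
      where
      g : V ⊎ A → Carrier
      g y = χ y * φ (just y)
      inner : ∀ v → ∑[ e ∈ arcs ] (⟦ t e ≟ v ⟧ * g (inj₂ e)) ≈
              ⟨ map (λ e → χ (inj₂ e) , just (inj₂ e)) (out D v) ∣ φ ⟩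
      inner v = ≈-trans (≈-sym (∑-filter (λ e → t e ≟ v) arcs _)) (reflexive (≡.sym (∑-map _ (out D v) _)))
      rows : ∀ x → 1# * φ nothing + (∑ vertices (λ v → ⟦ middleArc? D x (inj₁ v) ⟧ * g (inj₁ v)) +
                    ∑ arcs (λ e → ⟦ middleArc? D x (inj₂ e) ⟧ * g (inj₂ e))) ≈ ⟨ middleRow x ∣ φ ⟩
      rows (inj₁ v) = +-congˡ (≈-trans
        (+-cong (≈-trans (∑-cong vertices λ _ → zeroˡ _) (∑-zero vertices)) (inner v))
        (+-identityˡ _))
      rows (inj₂ e) = begin
        1# * φ nothing + (∑ vertices (λ v → ⟦ h e ≟ v ⟧ * g (inj₁ v)) + ∑ arcs (λ f → ⟦ h e ≟ t f ⟧ * g (inj₂ f)))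
          ≈⟨ +-congˡ (+-cong (∑-single _≟_ (complete (h e)) unique (g ∘ inj₁))
               (≈-trans (∑-cong arcs λ f → *-congʳ (reflexive (⟦⟧-cong (h e ≟ t f) (t f ≟ h e) ≡.sym ≡.sym)))
                        (inner (h e)))) ⟩
        1# * φ nothing + (g (inj₁ (h e)) + ⟨ map (λ e → χ (inj₂ e) , just (inj₂ e)) (out D (h e)) ∣ φ ⟩)
          ≈⟨ ≈-trans (≈-sym (+-assoc _ _ _)) (≈-trans (+-congʳ (+-comm _ _)) (+-assoc _ _ _)) ⟩
        ⟨ middleRow (inj₂ e) ∣ φ ⟩ ∎

    -- The root option counts 0, and what remains is the sum `d v` of the theorem.
    escaping-middle : ∀ v → escaping (middleRow (inj₁ v)) ≈ ∑ (out D v) (χ ∘ inj₂)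
    escaping-middle v = ≈-trans (+-cong (zeroʳ 1#) (≈-trans (reflexive (∑-map _ (out D v) _))
      (∑-cong (out D v) λ e → *-identityʳ _))) (+-identityˡ _)

    headRow : A → Row (Maybe (V ⊎ A))
    headRow e = (1# , just (inj₁ (h e))) ∷ []

    contracted : List A → V ⊎ A → Row (Maybe (V ⊎ A))
    contracted []       = middleRow
    contracted (e ∷ es) = Update._[_≔_] 𝓜._≟_ (contracted es) (inj₂ e) (headRow e)

    contracted-inj₁ : ∀ es v → contracted es (inj₁ v) ≡ middleRow (inj₁ v)
    contracted-inj₁ []       v = refl
    contracted-inj₁ (e ∷ es) v = contracted-inj₁ es v

    contracted-∉ : ∀ {es e} → e ∉ es → contracted es (inj₂ e) ≡ middleRow (inj₂ e)
    contracted-∉ {[]}     e∉ = refl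
    contracted-∉ {f ∷ es} e∉ = ≡.trans
      (Update.update-other 𝓜._≟_ (contracted es) (e∉ ∘ here ∘ Sum.inj₂-injective))
      (contracted-∉ (e∉ ∘ there))

    contracted-∈ : ∀ {es e} → e ∈ es → contracted es (inj₂ e) ≡ headRow e
    contracted-∈ {f ∷ es} {e} e∈ with e ≟ᴬ f
    ... | yes refl = Update.update-same 𝓜._≟_ (contracted es) (inj₂ e) (headRow e)
    ... | no e≢f   = ≡.trans
      (Update.update-other 𝓜._≟_ (contracted es) (e≢f ∘ Sum.inj₂-injective))
      (contracted-∈ (tail e∈))
      where
      tail : e ∈ f ∷ es → e ∈ es
      tail (here e≡f) = contradiction e≡f e≢f
      tail (there e∈) = e∈

    treeTotal : (V ⊎ A → Row (Maybe (V ⊎ A))) → Carrier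
    treeTotal ρ = total 𝓜._≟_ 𝓜.vertices ρ isTree (const nothing)

    -- One exchange per arc. The row of `e` is still the original one because `e ∉ es`, and the row
    -- of its head is untouched because only arc rows are replaced; hence the factor involves
    -- nothing but the head.
    contract-arcs : ∀ {es} → Unique es → treeTotal middleRow ≈
      ∏ es (λ e → χ (inj₁ (h e)) + ∑ (out D (h e)) (χ ∘ inj₂)) * treeTotal (contracted es)
    contract-arcs {[]}     _        = ≈-sym (*-identityˡ _)
    contract-arcs {e ∷ es} (e∉ ∷ u) = begin
      treeTotal middleRow
        ≈⟨ contract-arcs u ⟩
      ∏ es s * treeTotal (contracted es)
        ≈⟨ *-congˡ (total-exchange {inj₂ e} {inj₁ (h e)} (λ ()) 𝓜-unique (𝓜-complete _) (𝓜-complete _)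
             {contracted es} {contracted (e ∷ es)} (χ (inj₁ (h e))) row-e row-e′ off (const nothing)) ⟩
      ∏ es s * ((χ (inj₁ (h e)) + escaping (contracted es (inj₁ (h e)))) * treeTotal (contracted (e ∷ es)))
        ≈⟨ *-congˡ (*-congʳ (+-congˡ (≈-trans (reflexive (≡.cong escaping (contracted-inj₁ es (h e))))
                                              (escaping-middle (h e))))) ⟩
      ∏ es s * (s e * treeTotal (contracted (e ∷ es)))
        ≈⟨ ≈-trans (≈-sym (*-assoc _ _ _)) (*-congʳ (*-comm _ _)) ⟩
      ∏ (e ∷ es) s * treeTotal (contracted (e ∷ es)) ∎
      where
      s : A → Carrier
      s e = χ (inj₁ (h e)) + ∑ (out D (h e)) (χ ∘ inj₂)
      row-e : contracted es (inj₂ e) ≋ (χ (inj₁ (h e)) , just (inj₁ (h e))) ∷ contracted es (inj₁ (h e))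
      row-e φ rewrite contracted-∉ {es} {e} (λ e∈ → All.lookup e∉ e∈ refl) | contracted-inj₁ es (h e) = ≈-refl
      row-e′ : contracted (e ∷ es) (inj₂ e) ≋ headRow e
      row-e′ φ rewrite Update.update-same 𝓜._≟_ (contracted es) (inj₂ e) (headRow e) = ≈-refl
      off : ∀ x → x ≢ inj₂ e → contracted es x ≡ contracted (e ∷ es) x
      off x x≢ = ≡.sym (Update.update-other 𝓜._≟_ (contracted es) x≢)

    -- Every arc now has a single option, of weight 1, so only the choices at the vertices of `D`
    -- remain. Choosing the arc `e` there amounts, after contraction, to moving to `h e` with weight
    -- `χ (inj₂ e)`, which is the row of `D`.
    treeTotal-contracted : treeTotal (contracted arcs) ≈
      total _≟_ vertices (treeRow D (χ ∘ inj₂)) E.isTree (const nothing)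
    treeTotal-contracted = begin
      treeTotal (contracted arcs)
        ≈⟨ total-++ 𝓜._≟_ (map inj₁ vertices) (map inj₂ arcs) ρ isTree (const nothing) ⟩
      total 𝓜._≟_ (map inj₁ vertices) ρ (total 𝓜._≟_ (map inj₂ arcs) ρ isTree) (const nothing)
        ≈⟨ total-cong 𝓜._≟_ (map inj₁ vertices) (λ _ _ _ → ≈-refl) arcs-fixed (const nothing) ⟩
      total 𝓜._≟_ (map inj₁ vertices) ρ (λ f → E.isTree (Maybe.map contract ∘ f ∘ inj₁)) (const nothing)
        ≈⟨ total-map 𝓜._≟_ _≟_ Sum.inj₁-injective (Maybe.map contract) vertices ρ E.isTree-ext (const nothing) ⟩
      total _≟_ vertices (λ v → map (map₂ (Maybe.map contract)) (ρ (inj₁ v))) E.isTree (const nothing)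
        ≈⟨ total-cong _≟_ vertices (λ v _ → rows v) (λ _ → ≈-refl) (const nothing) ⟩
      total _≟_ vertices (treeRow D (χ ∘ inj₂)) E.isTree (const nothing) ∎
      where
      ρ : V ⊎ A → Row (Maybe (V ⊎ A))
      ρ = contracted arcs
      contract : V ⊎ A → V
      contract = Sum.[ id , h ]
      arcs-fixed : ∀ f → total 𝓜._≟_ (map inj₂ arcs) ρ isTree f ≈ E.isTree (Maybe.map contract ∘ f ∘ inj₁)
      arcs-fixed f = ≈-trans
        (total-unit 𝓜._≟_ (map inj₂ arcs) ρ isTree-ext f f′
          (λ x x∈ → case ∈-map⁻ inj₂ x∈ of λ where (e , e∈ , refl) → contracted-∈ e∈)
          (λ where (inj₁ v) _  → refl
                   (inj₂ e) e∉ → contradiction (∈-map⁺ inj₂ (arcs-complete e)) e∉))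
        (reflexive (⟦⟧-cong (tree? 𝓜.V-finite f′) (tree? V-finite _)
          (contract-tree {F = f′} λ _ → refl) (expand-tree {F = f′} λ _ → refl)))
        -- `f′` is the only map the arc rows allow: it agrees with `f` on the vertices of `D` and
        -- sends each arc to its head.
        where
        f′ : V ⊎ A → Maybe (V ⊎ A)
        f′ = Sum.[ f ∘ inj₁ , (λ e → just (inj₁ (h e))) ]
      rows : ∀ v → map (map₂ (Maybe.map contract)) (ρ (inj₁ v)) ≋ treeRow D (χ ∘ inj₂) v
      rows v φ rewrite contracted-inj₁ arcs v = +-congˡ (reflexive (≡.trans
        (≡.trans (∑-map _ (map _ (out D v)) _) (∑-map _ (out D v) _))
        (≡.sym (≡.trans (∑-map _ (map _ (out D v)) _) (∑-map _ (out D v) _)))))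

    ∑-spanningTrees-middle :
      ∑[ T ∈ 𝓜.spanningTrees ] ∏ T (χ ∘ 𝓜.h) ≈
      (∑[ T ∈ spanningTrees ] ∏ T (χ ∘ inj₂)) *
      ∏ arcs (λ e → χ (inj₁ (h e)) + ∑ (out D (h e)) (χ ∘ inj₂))
    ∑-spanningTrees-middle = begin
      ∑[ T ∈ 𝓜.spanningTrees ] ∏ T (χ ∘ 𝓜.h)
        ≈⟨ ∑-spanningTrees (M D) (χ ∘ 𝓜.h) ⟩
      treeTotal (treeRow (M D) (χ ∘ 𝓜.h))
        ≈⟨ total-cong 𝓜._≟_ 𝓜.vertices (λ x _ → treeRow-middle x) (λ _ → ≈-refl) (const nothing) ⟩
      treeTotal middleRow
        ≈⟨ contract-arcs arcs-unique ⟩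
      ∏ arcs _ * treeTotal (contracted arcs)
        ≈⟨ *-congˡ (≈-trans treeTotal-contracted (≈-sym (∑-spanningTrees D (χ ∘ inj₂)))) ⟩
      ∏ arcs _ * (∑[ T ∈ spanningTrees ] ∏ T (χ ∘ inj₂))
        ≈⟨ *-comm _ _ ⟩
      (∑[ T ∈ spanningTrees ] ∏ T (χ ∘ inj₂)) * ∏ arcs _ ∎

theorem5 : ∀ {c ℓ₁ ℓ₂ ℓ₃} (F : OrderedField c ℓ₁ ℓ₂ ℓ₃) (D : Digraph) →
    let open Complexity F
        open Digraph D in
    IsConnected D →
    (χ : V ⊎ A → Carrier) → (∀ x → 0# < χ x) →
    κ-vertex (M D) χ
      ≈ κ-edge D (χ ∘ inj₂) * (∏[ v ∈ vertices ] ((χ (inj₁ v) + d D (χ ∘ inj₂) v) ^ d₋ v))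
theorem5 F D _ χ _ = ≈-trans (∑-spanningTrees-middle χ)
  -- Each factor depends on its arc only through the head, so grouping arcs by head yields powers
  -- with exponents `d₋ v`.
  (*-congˡ (∏-^-count _≟_ (Finite.complete V-finite) (Finite.unique V-finite) h
    (λ v → χ (inj₁ v) + ∑ (out D v) (χ ∘ inj₂)) arcs))
  where
  open Digraph D
  R : CommutativeSemiring _ _
  R = CommutativeRing.commutativeSemiring (OrderedField.commutativeRing F)
  open CommutativeSemiring R using (*-congˡ; _+_) renaming (trans to ≈-trans)
  open Sums R using (∑; ∏-^-count)
  open Middle R D
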